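{- Let $G$ be a connected, well-edge-dominated graph containing exactly one triangle $xyz$. If $G-N_e[xy]$ contains exactly one nontrivial component and each of $x,y,z$ has degree at least $3$ in $G$, then $G=Cr$.
   Context: All graphs are simple and finite. A set $F$ of edges of $G$ is an edge dominating set if every edge of $G$ is in $F$ or shares an endpoint with an edge of $F$. $G$ is well-edge-dominated if all minimal (with respect to inclusion) edge dominating sets of $G$ have the same cardinality. A triangle is a subgraph isomorphic to $K_3$. $G-N_e[xy]$ denotes the graph obtained from $G$ by deleting $x$ and $y$ (and all incident edges). A graph is nontrivial if it has at least two vertices. The crystal graph $Cr$ has vertices $t_1,t_2,t_3,u_1,u_2,u_3,u_4$ and edges $t_1t_2,t_2t_3,t_3t_1,u_1u_2,u_2u_3,u_3u_4,u_4u_1,t_1u_2,t_2u_1,t_3u_4$; equality is up to isomorphism. -}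

module Defs where

open import Data.Nat using (ℕ; zero; suc; _+_)
open import Data.Bool using (Bool; true; false; T; _∨_; _∧_; if_then_else_)
open import Data.Fin using (Fin; toℕ; _<?_) renaming (zero to f0; suc to fs)
open import Data.Fin.Properties using (_≟_)
open import Data.List using (List; []; _∷_; map; allFin)
open import Data.Nat.ListAction using (sum)
open import Data.Bool.ListAction using (any)
open import Data.Product using (Σ; _×_; _,_; ∃; ∃-syntax)
open import Data.Sum using (_⊎_)
open import Data.Empty using (⊥)
open import Relation.Nullary using (¬_)
open import Relation.Nullary.Decidable using (⌊_⌋)
open import Relation.Binary.PropositionalEquality using (_≡_; refl)
open import Function.Bundles using (_⤖_; Bijection)
open import Function using (_∘_)

record Graph : Set where
  field
    n     : ℕ
    adj   : Fin n → Fin n → Bool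
    sym   : ∀ i j → adj i j ≡ adj j i
    irrefl : ∀ i → adj i i ≡ false
open Graph public

Adj : (G : Graph) → Fin (n G) → Fin (n G) → Set
Adj G u v = T (adj G u v)

count : {m : ℕ} → (Fin m → Bool) → ℕ
count {m} p = sum (map (λ i → if p i then 1 else 0) (allFin m))

degree : (G : Graph) → Fin (n G) → ℕ
degree G v = count (adj G v)

data WalkAvoiding (G : Graph) (avoid : Fin (n G) → Bool) :
       Fin (n G) → Fin (n G) → Set where
  stay : ∀ {u} → avoid u ≡ false → WalkAvoiding G avoid u u
  step : ∀ {u v w} → avoid u ≡ false → Adj G u v →
         WalkAvoiding G avoid v w → WalkAvoiding G avoid u w

Connected : Graph → Set
Connected G = ∀ u v → WalkAvoiding G (λ _ → false) u v

IsTriangle : (G : Graph) → Fin (n G) → Fin (n G) → Fin (n G) → Set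
IsTriangle G x y z =
  (¬ x ≡ y) × (¬ y ≡ z) × (¬ x ≡ z) × Adj G x y × Adj G y z × Adj G x z

_∈₃_ : {m : ℕ} → Fin m → (Fin m × Fin m × Fin m) → Set
a ∈₃ (x , y , z) = a ≡ x ⊎ a ≡ y ⊎ a ≡ z

UniqueTriangle : (G : Graph) → Fin (n G) → Fin (n G) → Fin (n G) → Set
UniqueTriangle G x y z =
  IsTriangle G x y z ×
  (∀ a b c → IsTriangle G a b c →
     a ∈₃ (x , y , z) × b ∈₃ (x , y , z) × c ∈₃ (x , y , z))

-- G - N_e[xy]: G with vertices x and y deleted

removed : (G : Graph) → Fin (n G) → Fin (n G) → Fin (n G) → Bool
removed G x y w = ⌊ w ≟ x ⌋ ∨ ⌊ w ≟ y ⌋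

EdgeOfDeleted : (G : Graph) → (x y u v : Fin (n G)) → Set
EdgeOfDeleted G x y u v =
  removed G x y u ≡ false × removed G x y v ≡ false × Adj G u v

-- A component of G - {x,y} is nontrivial iff it contains an edge.
-- G - {x,y} has exactly one nontrivial component: there is an edge, and
-- any two edges lie in the same component.
ExactlyOneNontrivialComponent : (G : Graph) → (x y : Fin (n G)) → Set
ExactlyOneNontrivialComponent G x y =
  (∃[ u ] ∃[ v ] EdgeOfDeleted G x y u v) ×
  (∀ u v u' v' → EdgeOfDeleted G x y u v → EdgeOfDeleted G x y u' v' →
     WalkAvoiding G (removed G x y) u u')

IsEdgeSet : (G : Graph) → (Fin (n G) → Fin (n G) → Bool) → Set
IsEdgeSet G F = (∀ u v → F u v ≡ F v u) × (∀ u v → T (F u v) → Adj G u v)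

_⊆E_ : {m : ℕ} → (Fin m → Fin m → Bool) → (Fin m → Fin m → Bool) → Set
F ⊆E F' = ∀ u v → T (F u v) → T (F' u v)

edgeCount : {m : ℕ} → (Fin m → Fin m → Bool) → ℕ
edgeCount {m} F = sum (map (λ i → count (λ j → ⌊ i <? j ⌋ ∧ F i j)) (allFin m))

IsEDS : (G : Graph) → (Fin (n G) → Fin (n G) → Bool) → Set
IsEDS G F = IsEdgeSet G F ×
  (∀ u v → Adj G u v →
     T (F u v) ⊎ (∃[ w ] (T (F u w) ⊎ T (F v w))))

IsMinimalEDS : (G : Graph) → (Fin (n G) → Fin (n G) → Bool) → Set
IsMinimalEDS G F = IsEDS G F ×
  (∀ F' → IsEDS G F' → F' ⊆E F → F ⊆E F')

WellEdgeDominated : Graph → Set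
WellEdgeDominated G = ∀ F₁ F₂ → IsMinimalEDS G F₁ → IsMinimalEDS G F₂ →
  edgeCount F₁ ≡ edgeCount F₂

-- The crystal graph Cr
-- vertices 0..6 = t1 t2 t3 u1 u2 u3 u4

crEdges : List (ℕ × ℕ)
crEdges = (0 , 1) ∷ (1 , 2) ∷ (2 , 0) ∷ (3 , 4) ∷ (4 , 5) ∷ (5 , 6) ∷
          (6 , 3) ∷ (0 , 4) ∷ (1 , 3) ∷ (2 , 6) ∷ []

open import Data.Nat using (_≡ᵇ_)

isCrEdge : Fin 7 → Fin 7 → Bool
isCrEdge i j = any (λ { (a , b) → (toℕ i ≡ᵇ a) ∧ (toℕ j ≡ᵇ b) }) crEdges

crAdj : Fin 7 → Fin 7 → Bool
crAdj i j = isCrEdge i j ∨ isCrEdge j i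

open import Data.Bool.Properties using (∨-comm)

crIrrefl : ∀ i → crAdj i i ≡ false
crIrrefl f0 = refl
crIrrefl (fs f0) = refl
crIrrefl (fs (fs f0)) = refl
crIrrefl (fs (fs (fs f0))) = refl
crIrrefl (fs (fs (fs (fs f0)))) = refl
crIrrefl (fs (fs (fs (fs (fs f0))))) = refl
crIrrefl (fs (fs (fs (fs (fs (fs f0)))))) = refl

Cr : Graph
Cr = record { n = 7 ; adj = crAdj ; sym = λ i j → ∨-comm (isCrEdge i j) (isCrEdge j i) ; irrefl = crIrrefl }

_≅_ : Graph → Graph → Set
G ≅ H = Σ (Fin (n G) ⤖ Fin (n H)) λ f →
  ∀ u v → adj G u v ≡ adj H (Bijection.to f u) (Bijection.to f v)

Fin' : Graph → Set
Fin' G = Fin (n G)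

{-# OPTIONS --safe #-}

-- Let T = {x, y, z} and R = G − T, and call the neighbours of x outside T the links of x. In a
-- well-edge-dominated graph all maximal matchings have the same size, because they are minimal edge
-- dominating sets. Comparing maximal matchings shows that every maximal matching of R covers every
-- link, that R is itself equimatchable, and that links x', y', z' are never pairwise nonadjacent.
-- If x' and y' are nonadjacent, then some vertex b of R has all its R-neighbours in {x', y'} and is
-- not adjacent to z: otherwise there is a minimal edge dominating set that contains zx and zy and
-- misses x' and y', and replacing zx, zy by xy makes it smaller. In an equimatchable triangle-free
-- graph the property of being covered by all maximal matchings spreads along the component of any
-- edge joining two such vertices. With these facts, a path x'y'z' of links (for some order of the
-- triangle) lies in a 4-cycle x'y'z'b that is a whole component of R and contains all links, so that
-- G = Cr. The uniqueness of the nontrivial component of G − {x, y} provides, in every nontrivial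
-- component of R, a link of z, and this forces such a path to exist.
module Submission where

open import Defs
open import Data.Nat using (ℕ; zero; suc; _+_; _≤_; _≥_; z≤n; s≤s)
open import Data.Nat.ListAction using (sum)
open import Data.Nat.Properties using (≤-refl; ≤-trans; ≤-reflexive; +-mono-≤; +-suc; 1+n≰n; 1+n≢n; m≤m+n; suc-injective)
open import Data.Bool using (Bool; true; false; T; _∨_; _∧_; if_then_else_)
open import Data.Bool.Properties using (T-∨; T-∧; T-≡) renaming (_≟_ to _≟ᵇ_)
open import Data.Fin using (Fin; zero; suc; _<?_) renaming (_<_ to _<ᶠ_)
open import Data.Fin.Patterns using (0F; 1F; 2F; 3F; 4F; 5F; 6F)
open import Data.Fin.Properties using (_≟_; any?; all?; <-cmp; <-asym) renaming (suc-injective to Fin-suc-injective)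
open import Data.List using (map; allFin)
open import Data.List.Properties using (map-tabulate)
open import Data.Product using (_×_; _,_; ∃; ∃-syntax; proj₁; proj₂)
open import Data.Sum using (_⊎_; inj₁; inj₂; [_,_]′) renaming (swap to ⊎-swap)
open import Data.Empty using (⊥; ⊥-elim)
open import Function using (_∘_; id)
open import Function.Bundles using (Equivalence; mk⤖)
open import Relation.Nullary using (¬_; Dec; yes; no)
open import Relation.Nullary.Decidable using (⌊_⌋; T?; _×-dec_; _⊎-dec_; _→-dec_; ¬?; toWitness; fromWitness; decidable-stable; toSum; map′)
open import Relation.Binary.Construct.Closure.ReflexiveTransitive using (Star; ε; _◅_; _◅◅_; reverse)
open import Relation.Binary.Definitions using (tri<; tri≈; tri>)
open import Relation.Binary.PropositionalEquality using (_≡_; _≢_; refl; cong; cong₂; trans; subst; ≢-sym) renaming (sym to ≡-sym)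

-- Edge sets as Boolean relations

EdgeSet : ℕ → Set
EdgeSet m = Fin m → Fin m → Bool

T-ext : ∀ {a b} → (T a → T b) → (T b → T a) → a ≡ b
T-ext {false} {false} f g = refl
T-ext {false} {true}  f g = ⊥-elim (g _)
T-ext {true}  {false} f g = ⊥-elim (f _)
T-ext {true}  {true}  f g = refl

¬T⇒false : ∀ {a} → ¬ T a → a ≡ false
¬T⇒false {false} _ = refl
¬T⇒false {true}  h = ⊥-elim (h _)

-- Counting edges

∑ : ∀ {m} → (Fin m → ℕ) → ℕ
∑ {m} f = sum (map f (allFin m))

∑-suc : ∀ {m} (f : Fin (suc m) → ℕ) → ∑ f ≡ f zero + ∑ (f ∘ suc)
∑-suc f = cong (λ l → f zero + sum l) (trans (map-tabulate suc f) (≡-sym (map-tabulate id (f ∘ suc))))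

∑-cong : ∀ {m} {f g : Fin m → ℕ} → (∀ i → f i ≡ g i) → ∑ f ≡ ∑ g
∑-cong {zero}  h = refl
∑-cong {suc m} {f} {g} h
  rewrite ∑-suc f | ∑-suc g = cong₂ _+_ (h zero) (∑-cong (h ∘ suc))

∑-mono : ∀ {m} {f g : Fin m → ℕ} → (∀ i → f i ≤ g i) → ∑ f ≤ ∑ g
∑-mono {zero}  h = z≤n
∑-mono {suc m} {f} {g} h
  rewrite ∑-suc f | ∑-suc g = +-mono-≤ (h zero) (∑-mono (h ∘ suc))

∑-point : ∀ {m} {f g : Fin m → ℕ} a → g a ≡ suc (f a) →
          (∀ i → i ≢ a → f i ≡ g i) → ∑ g ≡ suc (∑ f)
∑-point {suc m} {f} {g} zero e h
  rewrite ∑-suc f | ∑-suc g = cong₂ _+_ e (≡-sym (∑-cong (λ i → h (suc i) λ ())))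
∑-point {suc m} {f} {g} (suc a) e h
  rewrite ∑-suc f | ∑-suc g =
  trans (cong₂ _+_ (≡-sym (h zero λ ()))
                   (∑-point a e (λ i i≢a → h (suc i) (i≢a ∘ Fin-suc-injective))))
        (+-suc (f zero) _)

bit : Bool → ℕ
bit b = if b then 1 else 0

bit-mono : ∀ {a b} → (T a → T b) → bit a ≤ bit b
bit-mono {false}         _ = z≤n
bit-mono {true}  {true}  _ = ≤-refl
bit-mono {true}  {false} h = ⊥-elim (h _)

-- The indicator of the pair `a`, `b` arises from the zero function by two one-point changes. This
-- bound later turns degree at least 3 into a neighbour outside the triangle.
count-pair : ∀ {m} {p : Fin m → Bool} {a b} → a ≢ b → (∀ i → T (p i) → i ≡ a ⊎ i ≡ b) → count p ≤ 2
count-pair {m} {p} {a} {b} a≢b within = ≤-trans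
  (∑-mono λ i → bit-mono λ t → fromWitness {a? = either? i} (within i t))
  (≤-reflexive (trans (∑-point b at-b (λ i → one≡either)) (cong suc (trans (∑-point a at-a none≡one) (cong suc (∑-zero m))))))
  where
  either? : ∀ i → Dec (i ≡ a ⊎ i ≡ b)
  either? i = i ≟ a ⊎-dec i ≟ b
  ∑-zero : ∀ k → ∑ {k} (λ _ → 0) ≡ 0
  ∑-zero zero    = refl
  ∑-zero (suc k) = trans (∑-suc {k} (λ _ → 0)) (∑-zero k)
  at-a : bit ⌊ a ≟ a ⌋ ≡ 1
  at-a with a ≟ a
  ... | yes _ = refl
  ... | no ne = ⊥-elim (ne refl)
  none≡one : ∀ i → i ≢ a → 0 ≡ bit ⌊ i ≟ a ⌋
  none≡one i i≢a with i ≟ a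
  ... | yes e = ⊥-elim (i≢a e)
  ... | no _  = refl
  at-b : bit ⌊ either? b ⌋ ≡ suc (bit ⌊ b ≟ a ⌋)
  at-b with b ≟ a | b ≟ b
  ... | yes e | _     = ⊥-elim (a≢b (≡-sym e))
  ... | no _  | yes _ = refl
  ... | no _  | no ne = ⊥-elim (ne refl)
  one≡either : ∀ {i} → i ≢ b → bit ⌊ i ≟ a ⌋ ≡ bit ⌊ either? i ⌋
  one≡either {i} i≢b with i ≟ a | i ≟ b
  ... | yes _ | _     = refl
  ... | no _  | yes e = ⊥-elim (i≢b e)
  ... | no _  | no _  = refl

edgeCount-mono : ∀ {m} {F F' : EdgeSet m} → F ⊆E F' → edgeCount F ≤ edgeCount F'
edgeCount-mono F⊆F' = ∑-mono λ i → ∑-mono λ j →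
  bit-mono (λ t → let (l , f) = Equivalence.to T-∧ t in Equivalence.from T-∧ (l , F⊆F' i j f))

edgeCount-cong : ∀ {m} {F F' : EdgeSet m} → (∀ u v → F u v ≡ F' u v) → edgeCount F ≡ edgeCount F'
edgeCount-cong e = ∑-cong λ i → ∑-cong λ j → cong (λ b → bit (⌊ i <? j ⌋ ∧ b)) (e i j)

-- `edgeCount` reads only the entries above the diagonal, so the two sets need only be compared
-- there. The difference is isolated first in row `a`, then in column `b`.
edgeCount-point : ∀ {m} {F F' : EdgeSet m} {a b} → a <ᶠ b → ¬ T (F a b) → T (F' a b) →
  (∀ i j → i <ᶠ j → ¬ (i ≡ a × j ≡ b) → F i j ≡ F' i j) → edgeCount F' ≡ suc (edgeCount F)
edgeCount-point {F = F} {F'} {a} {b} a<b ¬Fab F'ab same =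
  ∑-point a (∑-point b at-ab row) λ i i≢a → ∑-cong λ j → off i j (λ (p , _) → i≢a p)
  where
  at-ab : bit (⌊ a <? b ⌋ ∧ F' a b) ≡ suc (bit (⌊ a <? b ⌋ ∧ F a b))
  at-ab with a <? b
  ... | no a≮b = ⊥-elim (a≮b a<b)
  ... | yes _ rewrite ¬T⇒false ¬Fab | Equivalence.to T-≡ F'ab = refl
  off : ∀ i j → ¬ (i ≡ a × j ≡ b) → bit (⌊ i <? j ⌋ ∧ F i j) ≡ bit (⌊ i <? j ⌋ ∧ F' i j)
  off i j ne with i <? j
  ... | no _    = refl
  ... | yes i<j = cong bit (same i j i<j ne)
  row : ∀ j → j ≢ b → bit (⌊ a <? j ⌋ ∧ F a j) ≡ bit (⌊ a <? j ⌋ ∧ F' a j)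
  row j j≢b = off a j (λ (_ , q) → j≢b q)

-- Adding and removing one edge

Pair : ∀ {m} → Fin m → Fin m → Fin m → Fin m → Set
Pair a b u v = (u ≡ a × v ≡ b) ⊎ (u ≡ b × v ≡ a)

pair? : ∀ {m} (a b u v : Fin m) → Dec (Pair a b u v)
pair? a b u v = (u ≟ a ×-dec v ≟ b) ⊎-dec (u ≟ b ×-dec v ≟ a)

pair-swap : ∀ {m} {a b u v : Fin m} → Pair a b u v → Pair a b v u
pair-swap (inj₁ (p , q)) = inj₂ (q , p)
pair-swap (inj₂ (p , q)) = inj₁ (q , p)

∅ : ∀ {m} → EdgeSet m
∅ _ _ = false

-- The Boolean formulas are sealed; nested additions and removals are handled through the membership
-- lemmas alone.
opaque
  add rem : ∀ {m} → Fin m → Fin m → EdgeSet m → EdgeSet m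
  add a b F u v = F u v ∨ ⌊ pair? a b u v ⌋
  rem a b F u v = F u v ∧ ⌊ ¬? (pair? a b u v) ⌋

module _ {m} {a b : Fin m} {F : EdgeSet m} where

  opaque
    unfolding add rem
    add⁻ : ∀ {u v} → T (add a b F u v) → T (F u v) ⊎ Pair a b u v
    add⁻ {u} {v} t with Equivalence.to T-∨ t
    ... | inj₁ f = inj₁ f
    ... | inj₂ p = inj₂ (toWitness p)

    add-pair : ∀ {u v} → Pair a b u v → T (add a b F u v)
    add-pair {u} {v} p = Equivalence.from (T-∨ {F u v}) (inj₂ (fromWitness {a? = pair? a b u v} p))

    add-⊇ : F ⊆E add a b F
    add-⊇ u v f = Equivalence.from T-∨ (inj₁ f)

    rem⁻ : ∀ {u v} → T (rem a b F u v) → T (F u v) × ¬ Pair a b u v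
    rem⁻ t = let (f , p) = Equivalence.to T-∧ t in f , toWitness p

    rem⁺ : ∀ {u v} → T (F u v) → ¬ Pair a b u v → T (rem a b F u v)
    rem⁺ f p = Equivalence.from T-∧ (f , fromWitness p)

  add-new : T (add a b F a b)
  add-new = add-pair (inj₁ (refl , refl))

  rem-⊆ : rem a b F ⊆E F
  rem-⊆ u v t = proj₁ (rem⁻ t)

  edgeCount-add : a ≢ b → ¬ T (F a b) → ¬ T (F b a) → edgeCount (add a b F) ≡ suc (edgeCount F)
  edgeCount-add a≢b ¬ab ¬ba with <-cmp a b
  ... | tri≈ _ a≡b _ = ⊥-elim (a≢b a≡b)
  ... | tri< a<b _ _ = edgeCount-point a<b ¬ab add-new λ i j i<j ne →
          T-ext (add-⊇ i j) λ t → [ id , (λ { (inj₁ p) → ⊥-elim (ne p)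
                                           ; (inj₂ (refl , refl)) → ⊥-elim (<-asym i<j a<b) }) ]′ (add⁻ t)
  ... | tri> _ _ b<a = edgeCount-point b<a ¬ba (add-pair (inj₂ (refl , refl))) λ i j i<j ne →
          T-ext (add-⊇ i j) λ t → [ id , (λ { (inj₂ p) → ⊥-elim (ne p)
                                           ; (inj₁ (refl , refl)) → ⊥-elim (<-asym i<j b<a) }) ]′ (add⁻ t)

edgeCount-rem : ∀ {m} {a b : Fin m} {F : EdgeSet m} → a ≢ b → T (F a b) → T (F b a) →
  edgeCount F ≡ suc (edgeCount (rem a b F))
edgeCount-rem {a = a} {b} {F} a≢b ab ba = trans (edgeCount-cong same)
  (edgeCount-add a≢b (λ t → proj₂ (rem⁻ t) (inj₁ (refl , refl)))
                     (λ t → proj₂ (rem⁻ t) (inj₂ (refl , refl))))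
  where
  same : ∀ u v → F u v ≡ add a b (rem a b F) u v
  same u v = T-ext fwd bwd
    where
    fwd : T (F u v) → T (add a b (rem a b F) u v)
    fwd f = [ add-pair , (λ ¬p → add-⊇ {F = rem a b F} u v (rem⁺ {F = F} f ¬p)) ]′ (toSum (pair? a b u v))
    bwd : T (add a b (rem a b F) u v) → T (F u v)
    bwd t with add⁻ t
    ... | inj₁ r = proj₁ (rem⁻ r)
    ... | inj₂ (inj₁ (refl , refl)) = ab
    ... | inj₂ (inj₂ (refl , refl)) = ba

-- A record rather than a Σ-type, so that unification recovers `F` and `u` from `Cover F u`.
record Cover {m} (F : EdgeSet m) (u : Fin m) : Set where
  constructor _,_
  field
    mate : Fin m
    edge : T (F u mate)

cover? : ∀ {m} (F : EdgeSet m) u → Dec (Cover F u)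
cover? F u = map′ (λ (w , t) → w , t) (λ (w , t) → w , t) (any? λ w → T? (F u w))

module _ {m} {a b : Fin m} {F : EdgeSet m} where

  cover-add⁻ : ∀ {u} → Cover (add a b F) u → Cover F u ⊎ (u ≡ a ⊎ u ≡ b)
  cover-add⁻ (w , t) with add⁻ t
  ... | inj₁ f = inj₁ (w , f)
  ... | inj₂ (inj₁ (p , _)) = inj₂ (inj₁ p)
  ... | inj₂ (inj₂ (p , _)) = inj₂ (inj₂ p)

  uncov-add : ∀ {u} → ¬ Cover F u → u ≢ a → u ≢ b → ¬ Cover (add a b F) u
  uncov-add nc p q c with cover-add⁻ c
  ... | inj₁ c'        = nc c'
  ... | inj₂ (inj₁ e) = p e
  ... | inj₂ (inj₂ e) = q e

  cover-add⁺ : ∀ {u} → Cover F u → Cover (add a b F) u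
  cover-add⁺ (w , f) = w , add-⊇ _ w f

  cover-addˡ : Cover (add a b F) a
  cover-addˡ = b , add-new

  cover-addʳ : Cover (add a b F) b
  cover-addʳ = a , add-pair (inj₂ (refl , refl))

cover-⊆ : ∀ {m} {F F' : EdgeSet m} → F ⊆E F' → ∀ {u} → Cover F u → Cover F' u
cover-⊆ s (w , f) = w , s _ w f

-- Matchings and edge dominating sets

module _ (G : Graph) where

  adj-sym : ∀ {u v} → Adj G u v → Adj G v u
  adj-sym {u} {v} = subst T (Graph.sym G u v)

  adj-irr : ∀ {u v} → Adj G u v → u ≢ v
  adj-irr {u} a refl = subst T (irrefl G u) a

  -- Edge domination in terms of covered vertices: an edge that lies in `F` covers its own
  -- endpoints, so the first alternative of `IsEDS` is absorbed.
  Dominating : EdgeSet (n G) → Set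
  Dominating F = ∀ u v → Adj G u v → Cover F u ⊎ Cover F v

  dominating? : ∀ F → Dec (Dominating F)
  dominating? F = all? λ u → all? λ v → T? (adj G u v) →-dec (cover? F u ⊎-dec cover? F v)

  edgeSet-sym : ∀ {F} → IsEdgeSet G F → ∀ {u v} → T (F u v) → T (F v u)
  edgeSet-sym (s , _) {u} {v} = subst T (s u v)

  edgeSet-add : ∀ {F a b} → IsEdgeSet G F → Adj G a b → IsEdgeSet G (add a b F)
  edgeSet-add {F} {a} {b} E ab = (λ u v → T-ext (flip u v) (flip v u)) , λ u v t → sub (add⁻ t)
    where
    flip : ∀ u v → T (add a b F u v) → T (add a b F v u)
    flip u v t with add⁻ t
    ... | inj₁ f = add-⊇ v u (edgeSet-sym E f)
    ... | inj₂ p = add-pair (pair-swap p)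
    sub : ∀ {u v} → T (F u v) ⊎ Pair a b u v → Adj G u v
    sub (inj₁ f) = proj₂ E _ _ f
    sub (inj₂ (inj₁ (refl , refl))) = ab
    sub (inj₂ (inj₂ (refl , refl))) = adj-sym ab

  edgeSet-rem : ∀ {F a b} → IsEdgeSet G F → IsEdgeSet G (rem a b F)
  edgeSet-rem {F} {a} {b} E = (λ u v → T-ext (flip u v) (flip v u)) , λ u v t → proj₂ E u v (proj₁ (rem⁻ t))
    where
    flip : ∀ u v → T (rem a b F u v) → T (rem a b F v u)
    flip u v t = let (f , p) = rem⁻ t in rem⁺ (edgeSet-sym E f) (p ∘ pair-swap)

  edgeSet-∅ : IsEdgeSet G ∅
  edgeSet-∅ = (λ _ _ → refl) , λ _ _ ()

  dominating⇒EDS : ∀ {F} → IsEdgeSet G F → Dominating F → IsEDS G F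
  dominating⇒EDS {F} E D = E , λ u v uv → dom (D u v uv)
    where
    dom : ∀ {u v} → Cover F u ⊎ Cover F v → T (F u v) ⊎ (∃[ w ] (T (F u w) ⊎ T (F v w)))
    dom (inj₁ (w , f)) = inj₂ (w , inj₁ f)
    dom (inj₂ (w , f)) = inj₂ (w , inj₂ f)

  EDS⇒dominating : ∀ {F} → IsEDS G F → Dominating F
  EDS⇒dominating (E , D) u v uv with D u v uv
  ... | inj₁ f            = inj₁ (v , f)
  ... | inj₂ (w , inj₁ f) = inj₁ (w , f)
  ... | inj₂ (w , inj₂ f) = inj₂ (w , f)

  opaque
    -- Edges are deleted while domination survives, with the edge count as fuel. Testing single
    -- deletions suffices: if a dominating `F'` inside `F` misses `ab`, then `rem a b F` contains
    -- `F'` and dominates too.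
    minimalEDS-in : ∀ F → IsEdgeSet G F → Dominating F → ∃[ F' ] (IsMinimalEDS G F' × F' ⊆E F)
    minimalEDS-in F E D = go (edgeCount F) F ≤-refl E D
      where
      go : ∀ fuel F → edgeCount F ≤ fuel → IsEdgeSet G F → Dominating F →
           ∃[ F' ] (IsMinimalEDS G F' × F' ⊆E F)
      go fuel F le E D
        with any? (λ a → any? (λ b → T? (F a b) ×-dec dominating? (rem a b F)))
      ... | no none = F , (dominating⇒EDS E D , minimal) , λ _ _ → id
        where
        minimal : ∀ F' → IsEDS G F' → F' ⊆E F → F ⊆E F'
        minimal F' D' F'⊆F a b f = decidable-stable (T? (F' a b)) λ ¬f' →
          none (a , b , f , λ u v uv → [ inj₁ ∘ keep ¬f' , inj₂ ∘ keep ¬f' ]′ (EDS⇒dominating D' u v uv))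
          where
          keep : ¬ T (F' a b) → ∀ {u} → Cover F' u → Cover (rem a b F) u
          keep ¬f' (w , f') = w , rem⁺ (F'⊆F _ w f')
            λ { (inj₁ (refl , refl)) → ¬f' f'
              ; (inj₂ (refl , refl)) → ¬f' (edgeSet-sym (proj₁ D') f') }
      ... | yes (a , b , f , D')
        with fuel | subst (_≤ fuel) (edgeCount-rem (adj-irr (proj₂ E a b f)) f (edgeSet-sym E f)) le
      ... | suc fuel' | s≤s le' =
        let (F' , m , s) = go fuel' (rem a b F) le' (edgeSet-rem E) D'
        in F' , m , λ u v t → rem-⊆ u v (s u v t)

  record Matching (M : EdgeSet (n G)) : Set where
    field
      edges  : IsEdgeSet G M
      unique : ∀ {u v w} → T (M u v) → T (M u w) → v ≡ w
  open Matching public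

  -- Maximality under inclusion: a matching can be enlarged exactly when some edge has both ends
  -- uncovered.
  Maximal : EdgeSet (n G) → Set
  Maximal M = Matching M × Dominating M

  matching-∅ : Matching ∅
  matching-∅ = record { edges = edgeSet-∅ ; unique = λ () }

  matching-add : ∀ {M a b} → Matching M → Adj G a b → ¬ Cover M a → ¬ Cover M b → Matching (add a b M)
  matching-add {M} {a} {b} mt ab ¬a ¬b = record { edges = edgeSet-add (edges mt) ab ; unique = λ s t → uniq (add⁻ s) (add⁻ t) }
    where
    uniq : ∀ {u v w} → T (M u v) ⊎ Pair a b u v → T (M u w) ⊎ Pair a b u w → v ≡ w
    uniq (inj₁ f) (inj₁ g) = unique mt f g
    uniq (inj₁ f) (inj₂ (inj₁ (refl , _))) = ⊥-elim (¬a (_ , f))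
    uniq (inj₁ f) (inj₂ (inj₂ (refl , _))) = ⊥-elim (¬b (_ , f))
    uniq (inj₂ (inj₁ (refl , _))) (inj₁ g) = ⊥-elim (¬a (_ , g))
    uniq (inj₂ (inj₂ (refl , _))) (inj₁ g) = ⊥-elim (¬b (_ , g))
    uniq (inj₂ (inj₁ (refl , p))) (inj₂ (inj₁ (_ , q))) = trans p (≡-sym q)
    uniq (inj₂ (inj₁ (refl , p))) (inj₂ (inj₂ (r , q))) = ⊥-elim (adj-irr ab r)
    uniq (inj₂ (inj₂ (refl , p))) (inj₂ (inj₁ (r , q))) = ⊥-elim (adj-irr ab (≡-sym r))
    uniq (inj₂ (inj₂ (refl , p))) (inj₂ (inj₂ (_ , q))) = trans p (≡-sym q)

  matching-rem : ∀ {M a b} → Matching M → Matching (rem a b M)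
  matching-rem mt = record { edges = edgeSet-rem (edges mt) ; unique = λ s t → unique mt (proj₁ (rem⁻ s)) (proj₁ (rem⁻ t)) }

  mate-sym : ∀ {M} → Matching M → ∀ {u v} → T (M u v) → T (M v u)
  mate-sym mt = edgeSet-sym (edges mt)

  uncov-remˡ : ∀ {M a b} → Matching M → T (M a b) → ¬ Cover (rem a b M) a
  uncov-remˡ mt ab (w , t) = let (f , p) = rem⁻ t in p (inj₁ (refl , unique mt f ab))

  uncov-remʳ : ∀ {M a b} → Matching M → T (M a b) → ¬ Cover (rem a b M) b
  uncov-remʳ mt ab (w , t) = let (f , p) = rem⁻ t in p (inj₂ (refl , unique mt f (mate-sym mt ab)))

  cover-rem : ∀ {M : EdgeSet (n G)} {a b u} → Cover M u → u ≢ a → u ≢ b → Cover (rem a b M) u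
  cover-rem {M} (w , f) p q = w , rem⁺ {F = M} f λ { (inj₁ (e , _)) → p e ; (inj₂ (e , _)) → q e }

  |matching-add| : ∀ {M a b} → Adj G a b → ¬ Cover M a → ¬ Cover M b → edgeCount (add a b M) ≡ suc (edgeCount M)
  |matching-add| ab ¬a ¬b = edgeCount-add (adj-irr ab) (λ t → ¬a (_ , t)) (λ t → ¬b (_ , t))

  |matching-rem| : ∀ {M a b} → Matching M → T (M a b) → edgeCount M ≡ suc (edgeCount (rem a b M))
  |matching-rem| mt ab = edgeCount-rem (adj-irr (proj₂ (edges mt) _ _ ab)) ab (mate-sym mt ab)

  opaque
    -- Greedy extension. The fuel bounds how many edges of `G` are still available; at fuel zero,
    -- one more edge would make the matching larger than the edge set of `G`.
    extend : ∀ {M} → Matching M → ∃[ M' ] (Maximal M' × M ⊆E M')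
    extend {M} mt = go (edgeCount (adj G)) M (m≤m+n _ _) mt
      where
      go : ∀ fuel M → edgeCount (adj G) ≤ fuel + edgeCount M → Matching M → ∃[ M' ] (Maximal M' × M ⊆E M')
      go fuel M le mt
        with any? (λ a → any? (λ b → T? (adj G a b) ×-dec (¬? (cover? M a) ×-dec ¬? (cover? M b))))
      ... | no none = M , (mt , dom) , λ _ _ → id
        where
        dom : Dominating M
        dom u v uv with cover? M u | cover? M v
        ... | yes c | _     = inj₁ c
        ... | no _  | yes c = inj₂ c
        ... | no p  | no q  = ⊥-elim (none (u , v , uv , p , q))
      ... | yes (a , b , ab , p , q) with fuel
      ...   | zero = ⊥-elim (1+n≰n (≤-trans (≤-reflexive (≡-sym (|matching-add| ab p q)))
                       (≤-trans (edgeCount-mono (proj₂ (edges (matching-add mt ab p q)))) le)))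
      ...   | suc k =
        let le' = ≤-trans le (≤-reflexive (trans (≡-sym (+-suc k _)) (cong (k +_) (≡-sym (|matching-add| ab p q)))))
            (M' , mx , s) = go k (add a b M) le' (matching-add mt ab p q)
        in M' , mx , λ u v t → s u v (add-⊇ u v t)

  -- An edge of `M` must be dominated by the smaller set `F'`, but the only edge of `M` that meets
  -- it is that edge itself.
  maximal⇒minimalEDS : ∀ {M} → Maximal M → IsMinimalEDS G M
  maximal⇒minimalEDS {M} (mt , dom) = dominating⇒EDS (edges mt) dom , minimal
    where
    minimal : ∀ F' → IsEDS G F' → F' ⊆E M → M ⊆E F'
    minimal F' D' F'⊆M u v f with EDS⇒dominating D' u v (proj₂ (edges mt) u v f)
    ... | inj₁ (w , f') with refl ← unique mt (F'⊆M u w f') f = f'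
    ... | inj₂ (w , f') with refl ← unique mt (F'⊆M v w f') (mate-sym mt f) = edgeSet-sym (proj₁ D') f'

-- Equimatchable triangle-free graphs

Equimatchable : Graph → Set
Equimatchable H = ∀ M M' → Maximal H M → Maximal H M' → edgeCount M ≡ edgeCount M'

TriangleFree : Graph → Set
TriangleFree H = ∀ a b c → Adj H a b → Adj H b c → ¬ Adj H a c

Essential : (H : Graph) → Fin (n H) → Set
Essential H s = ∀ M → Maximal H M → Cover M s

module _ {H : Graph} where

  maximal-with : ∀ {p q} → Adj H p q → ∃[ M ] (Maximal H M × T (M p q))
  maximal-with {p} {q} pq =
    let (M , mx , s) = extend H (matching-add H (matching-∅ H) pq (λ ()) (λ ()))
    in M , mx , s _ _ (add-new {F = ∅})

  maximal-with₂ : ∀ {p q r w} → Adj H p q → Adj H r w → r ≢ p → r ≢ q → w ≢ p → w ≢ q →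
    ∃[ M ] (Maximal H M × T (M p q) × T (M r w))
  maximal-with₂ {p} {q} {r} {w} pq rw a b c d =
    let (M , mx , s) = extend H (matching-add H (matching-add H (matching-∅ H) pq (λ ()) (λ ())) rw
                         (uncov-add (λ ()) a b) (uncov-add (λ ()) c d))
    in M , mx , s _ _ (add-⊇ _ _ (add-new {F = ∅})) , s _ _ (add-new {F = add p q ∅})

module EquimatchableTriangleFree {H : Graph} (equi : Equimatchable H) (tf : TriangleFree H) where

  private
    Ess = Essential H
    asym : ∀ {u v} → Adj H u v → Adj H v u
    asym = adj-sym H
    _~_ = Adj H

  -- In an equimatchable graph a maximal matching has maximum size, so no matching of that size can
  -- be extended.
  maximal-by-size : ∀ {M M'} → Maximal H M → Matching H M' → edgeCount M' ≡ edgeCount M → Maximal H M'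
  maximal-by-size {M} {M'} mx mt' e = mt' , dom
    where
    dom : Dominating H M'
    dom u v uv with cover? M' u | cover? M' v
    ... | yes c | _     = inj₁ c
    ... | no _  | yes c = inj₂ c
    ... | no p  | no q  =
      let (M'' , mx'' , s) = extend H (matching-add H mt' uv p q)
      in ⊥-elim (1+n≰n (≤-trans (≤-reflexive (trans (cong suc (≡-sym e)) (≡-sym (|matching-add| H uv p q))))
           (≤-trans (edgeCount-mono s) (≤-reflexive (equi M'' M mx'' mx)))))

  -- The edge at `p` swings from `q` to the uncovered vertex `b`. The size is unchanged, hence so is
  -- maximality.
  rotate : ∀ {M p q b} → Maximal H M → T (M p q) → p ~ b → ¬ Cover M b →
    Maximal H (add p b (rem p q M))
  rotate mx@(mt , _) pq pb ¬b = maximal-by-size mx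
    (matching-add H (matching-rem H mt) pb (uncov-remˡ H mt pq) ¬b')
    (trans (|matching-add| H pb (uncov-remˡ H mt pq) ¬b') (≡-sym (|matching-rem| H mt pq)))
    where ¬b' = ¬b ∘ cover-⊆ rem-⊆

  rotate-uncovers : ∀ {M p q b} → Maximal H M → T (M p q) → ¬ Cover M b → ¬ Cover (add p b (rem p q M)) q
  rotate-uncovers (mt , _) pq ¬b = uncov-add (uncov-remʳ H mt pq)
    (λ { refl → adj-irr H (proj₂ (edges mt) _ _ pq) refl })
    (λ { refl → ¬b (_ , mate-sym H mt pq) })

  -- Were `b` uncovered, swinging `pq` to `pb` would give a maximal matching that misses the
  -- essential vertex `q`.
  swap : ∀ {M p q b} → Maximal H M → T (M p q) → Ess q → p ~ b → Cover M b
  swap {M} {b = b} mx pq essq pb = decidable-stable (cover? M b) λ ¬b →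
    rotate-uncovers mx pq ¬b (essq _ (rotate mx pq pb ¬b))

  -- If M misses w and contains ty and ss₁, then M − ty − ss₁ + st is again maximal.
  spread : ∀ {s t w} → Ess s → Ess t → s ~ t → t ~ w → Ess w
  spread {s} {t} {w} es et st tw M mx@(mt , dom) = decidable-stable (cover? M w) absurd
    where
    absurd : ¬ ¬ Cover M w
    absurd ¬w = smaller (et M mx) (es M mx)
     where
     smaller : Cover M t → Cover M s → ⊥
     smaller (y , ty) (s₁ , ss₁) = 1+n≢n (trans (≡-sym |M|) same-size)
      where
      y≢s : y ≢ s
      -- If `s` were the mate of `t`, then `swap` would cover `w`, a neighbour of `t`.
      y≢s refl = ¬w (swap mx ty es tw)
      s₁≢t : s₁ ≢ t
      s₁≢t refl = y≢s (unique mt ty (mate-sym H mt ss₁))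
      s≢t = adj-irr H st
      N = rem s s₁ M
      mtN = matching-rem H {a = s} {s₁} mt
      Nty : T (N t y)
      Nty = rem⁺ {F = M} ty λ { (inj₁ (p , _)) → s≢t (≡-sym p) ; (inj₂ (p , _)) → s₁≢t (≡-sym p) }
      M₀ = rem t y N
      ¬M₀s : ¬ Cover M₀ s
      ¬M₀s = uncov-remˡ H mt ss₁ ∘ cover-⊆ rem-⊆
      ¬M₀t : ¬ Cover M₀ t
      ¬M₀t = uncov-remˡ H mtN Nty
      M₂ = add s t M₀
      mt₂ : Matching H M₂
      mt₂ = matching-add H (matching-rem H mtN) st ¬M₀s ¬M₀t
      |M| : edgeCount M ≡ suc (edgeCount M₂)
      |M| = trans (|matching-rem| H mt ss₁) (cong suc (trans (|matching-rem| H mtN Nty)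
              (≡-sym (|matching-add| H st ¬M₀s ¬M₀t))))
      M' = add t w (rem t y M)
      mx' : Maximal H M'
      mx' = rotate mx ty tw ¬w
      M's₁s : T (M' s₁ s)
      M's₁s = add-⊇ _ _ (rem⁺ {F = M} (mate-sym H mt ss₁)
        λ { (inj₁ (p , _)) → s₁≢t p ; (inj₂ (_ , q)) → s≢t q })
      -- Besides the vertices missed by `M`, the matching `M₂` can miss only `y` and `s₁`. It is
      -- maximal once no two such vertices are adjacent.
      Lost : Fin (n H) → Set
      Lost u = ¬ Cover M u ⊎ (u ≡ y ⊎ u ≡ s₁)
      lost : ∀ {u} → ¬ Cover M₂ u → Lost u
      lost {u} ¬u with cover? M u | u ≟ y | u ≟ s₁ | u ≟ s | u ≟ t
      ... | no ¬c | _ | _ | _ | _ = inj₁ ¬c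
      ... | _ | yes p | _ | _ | _ = inj₂ (inj₁ p)
      ... | _ | _ | yes p | _ | _ = inj₂ (inj₂ p)
      ... | _ | _ | _ | yes refl | _ = ⊥-elim (¬u cover-addˡ)
      ... | _ | _ | _ | _ | yes refl = ⊥-elim (¬u cover-addʳ)
      ... | yes c | no a | no b | no d | no e = ⊥-elim (¬u (cover-add⁺ (cover-rem H (cover-rem H c d b) e a)))
      s₁-unc : ∀ {u} → s₁ ~ u → ¬ ¬ Cover M u
      s₁-unc a ¬u = ¬u (swap mx (mate-sym H mt ss₁) es a)
      -- Swinging `ty` to `tw` uncovers `y` and keeps `s₁s`, so `swap` applies to the new matching
      -- `M'`.
      y-s₁ : ¬ s₁ ~ y
      y-s₁ a = rotate-uncovers mx ty ¬w (swap mx' M's₁s es a)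
      -- For `u = w` the edge `yw` closes a triangle with `t`; any other `u` missed by `M` is missed
      -- by `M'` together with `y`.
      y-unc : ∀ {u} → y ~ u → ¬ ¬ Cover M u
      y-unc {u} a ¬u with u ≟ w
      ... | yes refl = tf t y w (proj₂ (edges mt) _ _ ty) a tw
      ... | no u≢w with proj₂ mx' y u a
      ...   | inj₁ c = rotate-uncovers mx ty ¬w c
      ...   | inj₂ c with cover-add⁻ c
      ...     | inj₁ c' = ¬u (cover-⊆ rem-⊆ c')
      ...     | inj₂ (inj₁ refl) = ¬u (et M mx)
      ...     | inj₂ (inj₂ p) = u≢w p
      clash : ∀ {u v} → u ~ v → Lost u → Lost v → ⊥
      clash a (inj₁ p) (inj₁ q) = [ p , q ]′ (dom _ _ a)
      clash a (inj₁ p) (inj₂ (inj₁ refl)) = y-unc (asym a) p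
      clash a (inj₁ p) (inj₂ (inj₂ refl)) = s₁-unc (asym a) p
      clash a (inj₂ (inj₁ refl)) (inj₁ q) = y-unc a q
      clash a (inj₂ (inj₂ refl)) (inj₁ q) = s₁-unc a q
      clash a (inj₂ (inj₁ refl)) (inj₂ (inj₁ refl)) = adj-irr H a refl
      clash a (inj₂ (inj₁ refl)) (inj₂ (inj₂ refl)) = y-s₁ (asym a)
      clash a (inj₂ (inj₂ refl)) (inj₂ (inj₁ refl)) = y-s₁ a
      clash a (inj₂ (inj₂ refl)) (inj₂ (inj₂ refl)) = adj-irr H a refl
      dom₂ : Dominating H M₂
      dom₂ u v uv with cover? M₂ u | cover? M₂ v
      ... | yes c | _     = inj₁ c
      ... | no _  | yes c = inj₂ c
      ... | no p  | no q  = ⊥-elim (clash uv (lost p) (lost q))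
      same-size : edgeCount M ≡ edgeCount M₂
      same-size = equi M M₂ mx (mt₂ , dom₂)

  -- `spread` consumes two consecutive essential vertices and yields the next one, so the pair moves
  -- along the walk.
  spread* : ∀ {s t w} → Ess s → Ess t → s ~ t → Star _~_ t w → Ess w
  spread* es et st ε        = et
  spread* es et st (tv ◅ r) = spread* et (spread es et st tv) tv r

  closed-backward : (P : Fin (n H) → Set) → (∀ {u v} → u ~ v → P v → P u) →
    ∀ {u v} → Star _~_ u v → P v → P u
  closed-backward P h ε       p = p
  closed-backward P h (a ◅ r) p = h a (closed-backward P h r p)

  -- Matching r with anything but its leaf b would leave b uncovered.
  leaf-component : ∀ {b r p} → Ess b → b ~ r → (∀ {v} → b ~ v → v ≡ r) → Star _~_ p r → p ≡ r ⊎ p ≡ b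
  leaf-component {b} {r} eb br leaf path =
    closed-backward (λ v → v ≡ r ⊎ v ≡ b) back path (inj₁ refl)
    where
    back : ∀ {u v} → u ~ v → v ≡ r ⊎ v ≡ b → u ≡ r ⊎ u ≡ b
    back uv (inj₂ refl) = inj₁ (leaf (asym uv))
    back {u} ur (inj₁ refl) with u ≟ b
    ... | yes p = inj₂ p
    ... | no u≢b with maximal-with (asym ur)
    ...   | M , mx@(mt , _) , Mru with eb M mx
    ...     | (m , bm) with refl ← leaf (proj₂ (edges mt) _ _ bm) =
      ⊥-elim (u≢b (unique mt Mru (mate-sym H mt bm)))

  -- Vertices with all neighbours in a given pair

  module _ {p q r b : Fin (n H)} where

    -- The essential vertex `b` needs a mate, and `p` is already taken by `q`.
    forced-mate : ∀ {M} → Maximal H M → T (M p q) → Ess b → b ≢ q → (∀ {v} → b ~ v → v ≡ p ⊎ v ≡ r) → T (M b r)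
    forced-mate {M} mx@(mt , _) pq eb b≢q Nb with eb M mx
    ... | (m , bm) with Nb (proj₂ (edges mt) _ _ bm)
    ...   | inj₁ refl = ⊥-elim (b≢q (unique mt (mate-sym H mt bm) pq))
    ...   | inj₂ refl = bm

  -- A maximal matching with `pq` forces both `b` and `b'` onto `r`, so they coincide. Their common
  -- vertex then has `r` as its only neighbour, and `leaf-component` leaves no room for `p`.
  no-split-leaf : ∀ {p q r b b'} → Ess p → Ess q → p ~ q → Star _~_ p r → p ≢ r → ¬ p ~ r →
    (b ~ p ⊎ b ~ r) → (∀ {v} → b ~ v → v ≡ p ⊎ v ≡ r) → b ≢ q →
    (b' ~ q ⊎ b' ~ r) → (∀ {v} → b' ~ v → v ≡ q ⊎ v ≡ r) → b' ≢ p → ⊥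
  no-split-leaf {p} {q} {r} {b} {b'} ep eq pq path p≢r ¬pr bpr Nb b≢q b'qr Nb' b'≢p
    with maximal-with pq
  ... | M , mx@(mt , _) , Mpq = contra b≡b'
    where
    ess : ∀ {v} → Star _~_ p v → Ess v
    ess = spread* eq ep (asym pq)
    reach : ∀ {u b} → Star _~_ p u → b ~ u → Star _~_ p b
    reach s a = s ◅◅ (asym a ◅ ε)
    eb : Ess b
    eb = ess ([ reach ε , reach path ]′ bpr)
    eb' : Ess b'
    eb' = ess ([ reach (pq ◅ ε) , reach path ]′ b'qr)
    Mbr : T (M b r)
    Mbr = forced-mate mx Mpq eb b≢q Nb
    b≡b' : b ≡ b'
    b≡b' = unique mt (mate-sym H mt Mbr) (mate-sym H mt (forced-mate mx (mate-sym H mt Mpq) eb' b'≢p Nb'))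
    br : b ~ r
    br = proj₂ (edges mt) _ _ Mbr
    contra : b ≡ b' → ⊥
    contra refl with leaf-component eb br leaf path
      where
      leaf : ∀ {v} → b ~ v → v ≡ r
      leaf a with Nb a | Nb' a
      ... | inj₂ e | _ = e
      ... | inj₁ _ | inj₂ e = e
      ... | inj₁ refl | inj₁ e = ⊥-elim (adj-irr H pq e)
    ... | inj₁ e = p≢r e
    ... | inj₂ refl = ¬pr br

  -- If `q` had a neighbour `v` other than `b`, a maximal matching with `pc` and `qv` would leave
  -- `b` no mate. So `b` is the only neighbour of `q`, and a maximal matching with `pb` misses `q`.
  no-side-path : ∀ {p c q b} → Ess p → Ess c → Ess q → p ~ c → ¬ c ~ q → ¬ p ~ q →
    b ~ p → (∀ {v} → b ~ v → v ≡ p ⊎ v ≡ q) → b ≢ c → ⊥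
  no-side-path {p} {c} {q} {b} ep ec eq pc ¬cq ¬pq bp Nb b≢c = clash (maximal-with (asym bp))
    where
    eb : Ess b
    eb = spread ec ep (asym pc) (asym bp)
    p≢q : p ≢ q
    p≢q refl = ¬cq (asym pc)
    Nq : ∀ {v} → q ~ v → v ≡ b
    Nq {v} qv with maximal-with₂ pc qv (≢-sym p≢q) (λ { refl → ¬pq pc })
                     (λ { refl → ¬pq (asym qv) }) (λ { refl → ¬cq (asym qv) })
    ... | M , mx@(mt , _) , Mpc , Mqv = unique mt Mqv (mate-sym H mt (forced-mate mx Mpc eb b≢c Nb))
    clash : ¬ (∃[ M ] (Maximal H M × T (M p b)))
    clash (M , mx@(mt , _) , Mpb) =
      let (m , Mqm) = eq M mx
          Mqb = subst (λ v → T (M q v)) (Nq (proj₂ (edges mt) _ _ Mqm)) Mqm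
      in p≢q (unique mt (mate-sym H mt Mpb) (mate-sym H mt Mqb))

  -- The part of the 4-cycle `p q r b` that `square` derives. With its hypotheses on `pq`, `qr` and
  -- the neighbours of `b`, the cycle is a whole component.
  record Square (p q r b : Fin (n H)) : Set where
    field
      bp : b ~ p
      br : b ~ r
      Np : ∀ {v} → p ~ v → v ≡ q ⊎ v ≡ b
      Nr : ∀ {v} → r ~ v → v ≡ q ⊎ v ≡ b
      Nq : ∀ {v} → q ~ v → v ≡ p ⊎ v ≡ r

  square : ∀ {p q r b} → Ess p → Ess q → Ess r → p ~ q → q ~ r → p ≢ r →
    (b ~ p ⊎ b ~ r) → (∀ {v} → b ~ v → v ≡ p ⊎ v ≡ r) → b ≢ q → Square p q r b
  square {p} {q} {r} {b} ep eq er pq qr p≢r bpr Nb b≢q = record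
    { bp = edge-to (asym qr) (⊎-swap ∘ Nb) ; br = edge-to pq Nb
    ; Np = Np ; Nr = Nr ; Nq = Nq }
    where
    eb : Ess b
    eb = [ (λ bp → spread eq ep (asym pq) (asym bp)) , (λ br → spread eq er qr (asym br)) ]′ bpr
    edge-to : ∀ {p r} → p ~ q → (∀ {v} → b ~ v → v ≡ p ⊎ v ≡ r) → b ~ r
    edge-to pq Nb = let (M , mx@(mt , _) , Mpq) = maximal-with pq
                    in proj₂ (edges mt) _ _ (forced-mate mx Mpq eb b≢q Nb)
    -- For any further neighbour `v` of `p`, a maximal matching with `pv` and `qr` would take both
    -- possible mates of `b`. Triangle-freeness ensures `v ≠ r`.
    corner : ∀ {p r} → p ~ q → q ~ r → p ≢ r → (∀ {v} → b ~ v → v ≡ p ⊎ v ≡ r) →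
      ∀ {v} → p ~ v → v ≡ q ⊎ v ≡ b
    corner {p} {r} pq qr p≢r Nb {v} pv with v ≟ q | v ≟ b
    ... | yes e | _ = inj₁ e
    ... | _ | yes e = inj₂ e
    ... | no v≢q | no v≢b
      with maximal-with₂ pv qr (≢-sym (adj-irr H pq)) (≢-sym v≢q) (≢-sym p≢r) (λ { refl → tf p q r pq qr pv })
    ...   | M , mx@(mt , _) , Mpv , Mqr =
      ⊥-elim (b≢q (unique mt (mate-sym H mt (forced-mate mx Mpv eb (≢-sym v≢b) Nb)) (mate-sym H mt Mqr)))
    Np : ∀ {v} → p ~ v → v ≡ q ⊎ v ≡ b
    Np = corner pq qr p≢r Nb
    Nr : ∀ {v} → r ~ v → v ≡ q ⊎ v ≡ b
    Nr = corner (asym qr) (asym pq) (≢-sym p≢r) (⊎-swap ∘ Nb)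
    Nq : ∀ {v} → q ~ v → v ≡ p ⊎ v ≡ r
    Nq {v} qv with v ≟ p | v ≟ r
    ... | yes e | _ = inj₁ e
    ... | _ | yes e = inj₂ e
    -- With `q` matched to `v`, both `p` and `r` would have to be matched to `b`.
    ... | no v≢p | no v≢r with maximal-with qv
    ...   | M , mx@(mt , _) , Mqv with ep M mx | er M mx
    ...     | (m , Mpm) | (m' , Mrm') with Np (proj₂ (edges mt) _ _ Mpm) | Nr (proj₂ (edges mt) _ _ Mrm')
    ...       | inj₁ refl | _ = ⊥-elim (v≢p (unique mt Mqv (mate-sym H mt Mpm)))
    ...       | _ | inj₁ refl = ⊥-elim (v≢r (unique mt Mqv (mate-sym H mt Mrm')))
    ...       | inj₂ refl | inj₂ refl = ⊥-elim (p≢r (unique mt (mate-sym H mt Mpm) (mate-sym H mt Mrm')))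

-- Matchings outside the triangle

module _ (G : Graph) (τ : Fin (n G) → Bool) where

  opaque
    outAdj : Fin (n G) → Fin (n G) → Bool
    outAdj u v = ⌊ T? (adj G u v) ×-dec (¬? (T? (τ u)) ×-dec ¬? (T? (τ v))) ⌋

    out⁻ : ∀ {u v} → T (outAdj u v) → Adj G u v × ¬ T (τ u) × ¬ T (τ v)
    out⁻ = toWitness

    out⁺ : ∀ {u v} → Adj G u v → ¬ T (τ u) → ¬ T (τ v) → T (outAdj u v)
    out⁺ a p q = fromWitness (a , p , q)

  Linked : Fin (n G) → Fin (n G) → Set
  Linked t s = Adj G t s × ¬ T (τ s)

  -- The vertices marked by τ are not removed but made isolated.
  Outside : Graph
  Outside = record
    { n = n G ; adj = outAdj
    ; sym = λ i j → T-ext flip flip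
    ; irrefl = λ i → ¬T⇒false λ t → adj-irr G (proj₁ (out⁻ t)) refl }
    where
    flip : ∀ {u v} → T (outAdj u v) → T (outAdj v u)
    flip t = let (a , p , q) = out⁻ t in out⁺ (adj-sym G a) q p

module _ {G : Graph} {τ : Fin (n G) → Bool} where

  private R = Outside G τ

  matching-lift : ∀ {M} → Matching R M → Matching G M
  matching-lift mt = record
    { edges = proj₁ (edges mt) , λ u v t → proj₁ (out⁻ G τ (proj₂ (edges mt) u v t))
    ; unique = unique mt }

  inside-uncov : ∀ {M u} → Matching R M → T (τ u) → ¬ Cover M u
  inside-uncov mt τu (w , t) = proj₁ (proj₂ (out⁻ G τ (proj₂ (edges mt) _ w t))) τu

  -- Edges that avoid the triangle are dominated by `M` already; only those with an end marked by
  -- `τ` need checking.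
  maximal-lift : ∀ {M M'} → Maximal R M → Matching G M' → M ⊆E M' →
    (∀ {u v} → T (τ u) → Adj G u v → Cover M' u ⊎ Cover M' v) → Maximal G M'
  maximal-lift {M} {M'} (mt , dom) mt' s c = mt' , dom'
    where
    dom' : Dominating G M'
    dom' u v uv with T? (τ u) | T? (τ v)
    ... | yes p | _     = c p uv
    ... | no _  | yes q = ⊎-swap (c q (adj-sym G uv))
    ... | no p  | no q  = [ inj₁ ∘ cover-⊆ s , inj₂ ∘ cover-⊆ s ]′ (dom u v (out⁺ G τ uv p q))

-- τ marks the vertices of the triangle. It is a separate parameter so that Outside G τ stays the
-- same when x, y, z are permuted.
record Setup (G : Graph) (τ : Fin (n G) → Bool) (x y z : Fin (n G)) : Set where
  field
    xy : Adj G x y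
    yz : Adj G y z
    xz : Adj G x z
    τx : T (τ x)
    τy : T (τ y)
    τz : T (τ z)
    τ⁻ : ∀ {u} → T (τ u) → u ∈₃ (x , y , z)
    only : ∀ a b c → Adj G a b → Adj G b c → Adj G a c → T (τ a)
    wed : WellEdgeDominated G

module _ {G : Graph} {τ : Fin (n G) → Bool} where

  rot : ∀ {x y z} → Setup G τ x y z → Setup G τ y z x
  rot s = record
    { xy = yz ; yz = adj-sym G xz ; xz = adj-sym G xy ; τx = τy ; τy = τz ; τz = τx
    ; τ⁻ = λ t → [ (λ e → inj₂ (inj₂ e)) , [ inj₁ , (λ e → inj₂ (inj₁ e)) ]′ ]′ (τ⁻ t)
    ; only = only ; wed = wed }
    where open Setup s

  swp : ∀ {x y z} → Setup G τ x y z → Setup G τ y x z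
  swp s = record
    { xy = adj-sym G xy ; yz = xz ; xz = yz ; τx = τy ; τy = τx ; τz = τz
    ; τ⁻ = λ t → [ (λ e → inj₂ (inj₁ e)) , [ inj₁ , (λ e → inj₂ (inj₂ e)) ]′ ]′ (τ⁻ t)
    ; only = only ; wed = wed }
    where open Setup s

  private
    V = Fin (n G)
    R = Outside G τ

    Link = Linked G τ

  module Basics {x y z} (S : Setup G τ x y z) where
    open Setup S public

    x≢y : x ≢ y
    x≢y = adj-irr G xy
    y≢z : y ≢ z
    y≢z = adj-irr G yz
    x≢z : x ≢ z
    x≢z = adj-irr G xz

    out≢ : ∀ {s t} → ¬ T (τ s) → T (τ t) → s ≢ t
    out≢ p q refl = p q

    disjoint : ∀ {s} → Link x s → ¬ Adj G y s
    disjoint (xs , ¬τs) ys = ¬τs (only _ _ _ (adj-sym G xs) xy (adj-sym G ys))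

    maximal-size : ∀ {M M'} → Maximal G M → Maximal G M' → edgeCount M ≡ edgeCount M'
    maximal-size {M} {M'} p q = wed M M' (maximal⇒minimalEDS G p) (maximal⇒minimalEDS G q)

    outside-triangleFree : TriangleFree R
    outside-triangleFree a b c ab bc ac =
      let (ab' , ¬τa , _) = out⁻ G τ ab
      in ¬τa (only a b c ab' (proj₁ (out⁻ G τ bc)) (proj₁ (out⁻ G τ ac)))

  -- A link s of x missed by M would allow M + xs + yz, which is too large unless links of both
  -- y and z are missed as well; but then M can be extended by three edges.
  link-covered : ∀ {x y z} → Setup G τ x y z → ∀ {s} → Link x s → Essential R s
  link-covered {x} {y} {z} S {s} (xs , ¬τs) M mx@(mtR , _) = decidable-stable (cover? M s) absurd
    where
    open Basics S
    mt = matching-lift mtR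
    ¬x = inside-uncov mtR τx
    ¬y = inside-uncov mtR τy
    ¬z = inside-uncov mtR τz
    Missed : V → V → Set
    Missed t u = Adj G t u × ¬ T (τ u) × ¬ Cover M u
    missed? : ∀ t → Dec (∃ (Missed t))
    missed? t = any? λ u → T? (adj G t u) ×-dec (¬? (T? (τ u)) ×-dec ¬? (cover? M u))
    not-missed : ∀ {t v} → ¬ ∃ (Missed t) → Adj G t v → ¬ T (τ v) → Cover M v
    not-missed none tv ¬τv = decidable-stable (cover? M _) λ ¬v → none (_ , tv , ¬τv , ¬v)
    absurd : ¬ ¬ Cover M s
    absurd ¬s = cases (missed? y) (missed? z)
      where
      mt₁ = matching-add G mt yz ¬y ¬z
      ¬x₁ = uncov-add ¬x x≢y x≢z
      ¬s₁ = uncov-add ¬s (out≢ ¬τs τy) (out≢ ¬τs τz)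
      A = add x s (add y z M)
      A⊇ : M ⊆E A
      A⊇ u v t = add-⊇ u v (add-⊇ u v t)
      maxA : Maximal G A
      maxA = maximal-lift mx (matching-add G mt₁ xs ¬x₁ ¬s₁) A⊇ (λ τu _ → inj₁ (inside (τ⁻ τu)))
        where
        inside : ∀ {u} → u ∈₃ (x , y , z) → Cover A u
        inside (inj₁ refl)        = cover-addˡ
        inside (inj₂ (inj₁ refl)) = cover-add⁺ cover-addˡ
        inside (inj₂ (inj₂ refl)) = cover-add⁺ cover-addʳ
      |A| : edgeCount A ≡ suc (suc (edgeCount M))
      |A| = trans (|matching-add| G xs ¬x₁ ¬s₁) (cong suc (|matching-add| G yz ¬y ¬z))
      -- If the third triangle vertex `w` has no missed neighbour outside, then `M + xt` is maximal
      -- in `G`, with one edge fewer than `A`.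
      one-more : ∀ {t w} → Adj G x t → T (τ t) → (∀ {u} → u ∈₃ (x , y , z) → u ≡ x ⊎ u ≡ t ⊎ u ≡ w) →
        ¬ ∃ (Missed w) → ⊥
      one-more {t} {w} xt τt other none = 1+n≢n (trans (≡-sym |A|) (trans (maximal-size maxA maxB) (|matching-add| G xt ¬x ¬t)))
        where
        ¬t = inside-uncov mtR τt
        B = add x t M
        inside : ∀ {u v} → u ≡ x ⊎ u ≡ t ⊎ u ≡ w → Adj G u v → Cover B u ⊎ Cover B v
        inside (inj₁ refl) _        = inj₁ cover-addˡ
        inside (inj₂ (inj₁ refl)) _ = inj₁ cover-addʳ
        inside {v = v} (inj₂ (inj₂ refl)) wv with T? (τ v)
        ... | no ¬τv = inj₂ (cover-add⁺ (not-missed none wv ¬τv))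
        ... | yes τv with other (τ⁻ τv)
        ...   | inj₁ refl        = inj₂ cover-addˡ
        ...   | inj₂ (inj₁ refl) = inj₂ cover-addʳ
        ...   | inj₂ (inj₂ refl) = ⊥-elim (adj-irr G wv refl)
        maxB : Maximal G B
        maxB = maximal-lift mx (matching-add G mt xt ¬x ¬t) add-⊇ (λ τu uv → inside (other (τ⁻ τu)) uv)
      cases : Dec (∃ (Missed y)) → Dec (∃ (Missed z)) → ⊥
      cases (no none) _ = one-more xz τz
        (λ { (inj₁ e) → inj₁ e ; (inj₂ (inj₁ e)) → inj₂ (inj₂ e) ; (inj₂ (inj₂ e)) → inj₂ (inj₁ e) }) none
      cases _ (no none) = one-more xy τy id none
      cases (yes (y' , yy' , ¬τy' , ¬y')) (yes (z' , zz' , ¬τz' , ¬z')) =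
        1+n≢n (trans (≡-sym |C|) (trans (maximal-size maxC maxA) |A|))
        where
        y'≢z' : y' ≢ z'
        y'≢z' refl = Basics.disjoint (rot S) (yy' , ¬τy') zz'
        s≢y' : s ≢ y'
        s≢y' refl = disjoint (xs , ¬τs) yy'
        s≢z' : s ≢ z'
        s≢z' refl = Basics.disjoint (rot (rot S)) (zz' , ¬τz') xs
        C₁ = add z z' M
        C₂ = add y y' C₁
        C = add x s C₂
        ¬y₁ = uncov-add ¬y y≢z (≢-sym (out≢ ¬τz' τy))
        ¬y'₁ = uncov-add ¬y' (out≢ ¬τy' τz) y'≢z'
        ¬x₂ = uncov-add (uncov-add ¬x x≢z (≢-sym (out≢ ¬τz' τx))) x≢y (≢-sym (out≢ ¬τy' τx))
        ¬s₂ = uncov-add (uncov-add ¬s (out≢ ¬τs τz) s≢z') (out≢ ¬τs τy) s≢y'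
        mtC = matching-add G (matching-add G (matching-add G mt zz' ¬z ¬z') yy' ¬y₁ ¬y'₁) xs ¬x₂ ¬s₂
        |C| : edgeCount C ≡ suc (suc (suc (edgeCount M)))
        |C| = trans (|matching-add| G xs ¬x₂ ¬s₂) (cong suc (trans (|matching-add| G yy' ¬y₁ ¬y'₁) (cong suc (|matching-add| G zz' ¬z ¬z'))))
        C⊇ : M ⊆E C
        C⊇ u v t = add-⊇ u v (add-⊇ u v (add-⊇ u v t))
        inside : ∀ {u} → u ∈₃ (x , y , z) → Cover C u
        inside (inj₁ refl)        = cover-addˡ
        inside (inj₂ (inj₁ refl)) = cover-add⁺ cover-addˡ
        inside (inj₂ (inj₂ refl)) = cover-add⁺ (cover-add⁺ cover-addˡ)
        maxC : Maximal G C
        maxC = maximal-lift mx mtC C⊇ (λ τu _ → inj₁ (inside (τ⁻ τu)))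

  module Structure {x y z} (S : Setup G τ x y z) where
    open Basics S

    essX : ∀ {s} → Link x s → Essential R s
    essX = link-covered S
    essY : ∀ {s} → Link y s → Essential R s
    essY = link-covered (rot S)
    essZ : ∀ {s} → Link z s → Essential R s
    essZ = link-covered (rot (rot S))

    -- The vertex `z` may stay uncovered, because its links are essential in `R` and so are covered
    -- by `M`.
    maximal-plus-xy : ∀ {M} → Maximal R M → Maximal G (add x y M) × edgeCount (add x y M) ≡ suc (edgeCount M)
    maximal-plus-xy {M} mx@(mtR , _) =
      maximal-lift mx (matching-add G (matching-lift mtR) xy ¬x ¬y) add-⊇ (λ τu uv → inside (τ⁻ τu) uv) ,
      |matching-add| G xy ¬x ¬y
      where
      ¬x = inside-uncov mtR τx
      ¬y = inside-uncov mtR τy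
      inside : ∀ {u v} → u ∈₃ (x , y , z) → Adj G u v → Cover (add x y M) u ⊎ Cover (add x y M) v
      inside (inj₁ refl) _ = inj₁ cover-addˡ
      inside (inj₂ (inj₁ refl)) _ = inj₁ cover-addʳ
      inside {v = v} (inj₂ (inj₂ refl)) zv with T? (τ v)
      ... | no ¬τv = inj₂ (cover-add⁺ (essZ (zv , ¬τv) M mx))
      ... | yes τv with τ⁻ τv
      ...   | inj₁ refl        = inj₂ cover-addˡ
      ...   | inj₂ (inj₁ refl) = inj₂ cover-addʳ
      ...   | inj₂ (inj₂ refl) = ⊥-elim (adj-irr G zv refl)

    outside-equimatchable : Equimatchable R
    outside-equimatchable M M' mx mx' =
      let (mg , e) = maximal-plus-xy mx ; (mg' , e') = maximal-plus-xy mx'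
      in suc-injective (trans (≡-sym e) (trans (maximal-size mg mg') e'))

    -- A maximal matching containing xx', yy', zz' leaves, without these, a matching of R
    -- to which R can add one edge at each of x', y', z'.
    no-independent-links : ∀ {x' y' z'} → Link x x' → Link y y' → Link z z' →
      ¬ Adj G x' y' → ¬ Adj G y' z' → ¬ Adj G x' z' → ⊥
    no-independent-links {x'} {y'} {z'} X@(xx' , ¬τx') Y@(yy' , ¬τy') Z@(zz' , ¬τz') ¬x'y' ¬y'z' ¬x'z'
      with extend G
        (matching-add G (matching-add G (matching-add G (matching-∅ G) zz' (λ ()) (λ ())) yy'
          (uncov-add (λ ()) y≢z (≢-sym (out≢ ¬τz' τy)))
          (uncov-add (λ ()) (out≢ ¬τy' τz) λ { refl → Basics.disjoint (rot S) Y zz' })) xx'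
          (uncov-add (uncov-add (λ ()) x≢z (≢-sym (out≢ ¬τz' τx))) x≢y (≢-sym (out≢ ¬τy' τx)))
          (uncov-add (uncov-add (λ ()) (out≢ ¬τx' τz) λ { refl → Basics.disjoint (rot (rot S)) Z xx' })
                     (out≢ ¬τx' τy) λ { refl → disjoint X yy' }))
    ... | M , mxM@(mt , _) , M⊇ = absurd
      where
      Mx : T (M x x')
      Mx = M⊇ _ _ (add-new {F = add y y' (add z z' ∅)})
      My : T (M y y')
      My = M⊇ _ _ (add-⊇ _ _ (add-new {F = add z z' ∅}))
      Mz : T (M z z')
      Mz = M⊇ _ _ (add-⊇ _ _ (add-⊇ _ _ (add-new {F = ∅})))
      N₁ = rem x x' M
      N₂ = rem y y' N₁
      N = rem z z' N₂
      mt₁ = matching-rem G {a = x} {x'} mt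
      mt₂ = matching-rem G {a = y} {y'} mt₁
      mtN = matching-rem G {a = z} {z'} mt₂
      N₁y : T (N₁ y y')
      N₁y = rem⁺ {F = M} My λ { (inj₁ (p , _)) → x≢y (≡-sym p) ; (inj₂ (p , _)) → out≢ ¬τx' τy (≡-sym p) }
      N₂z : T (N₂ z z')
      N₂z = rem⁺ {F = N₁} (rem⁺ {F = M} Mz
              λ { (inj₁ (p , _)) → x≢z (≡-sym p) ; (inj₂ (p , _)) → out≢ ¬τx' τz (≡-sym p) })
              λ { (inj₁ (p , _)) → y≢z (≡-sym p) ; (inj₂ (p , _)) → out≢ ¬τy' τz (≡-sym p) }
      |M| : edgeCount M ≡ suc (suc (suc (edgeCount N)))
      |M| = trans (|matching-rem| G mt Mx) (cong suc (trans (|matching-rem| G mt₁ N₁y) (cong suc (|matching-rem| G mt₂ N₂z))))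
      drop₁ : ∀ {u} → ¬ Cover N₁ u → ¬ Cover N u
      drop₁ h = h ∘ cover-⊆ rem-⊆ ∘ cover-⊆ rem-⊆
      drop₂ : ∀ {u} → ¬ Cover N₂ u → ¬ Cover N u
      drop₂ h = h ∘ cover-⊆ rem-⊆
      ¬Nx' = drop₁ (uncov-remʳ G mt Mx)
      ¬Ny' = drop₂ (uncov-remʳ G mt₁ N₁y)
      ¬Nz' = uncov-remʳ G mt₂ N₂z
      ¬Nτ : ∀ {u} → T (τ u) → ¬ Cover N u
      ¬Nτ τu with τ⁻ τu
      ... | inj₁ refl        = drop₁ (uncov-remˡ G mt Mx)
      ... | inj₂ (inj₁ refl) = drop₂ (uncov-remˡ G mt₁ N₁y)
      ... | inj₂ (inj₂ refl) = uncov-remˡ G mt₂ N₂z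
      mtR : Matching R N
      mtR = record
        { edges = proj₁ (edges mtN) , λ u v t → out⁺ G τ (proj₂ (edges mtN) u v t)
            (λ τu → ¬Nτ τu (v , t)) (λ τv → ¬Nτ τv (u , mate-sym G mtN t))
        ; unique = unique mtN }
      x'≢y' : x' ≢ y'
      x'≢y' refl = disjoint X yy'
      y'≢z' : y' ≢ z'
      y'≢z' refl = Basics.disjoint (rot S) Y zz'
      x'≢z' : x' ≢ z'
      x'≢z' refl = Basics.disjoint (rot (rot S)) Z xx'
      -- `K` contains `N` and three more edges, distinct because `x'`, `y'`, `z'` are pairwise
      -- nonadjacent. So `K` has at least as many edges as `M`, although `K + xy` is a maximal
      -- matching of `G`.
      overfull : ∀ {K p q r} → Maximal R K → N ⊆E K → T (K x' p) → T (K y' q) → T (K z' r) → ⊥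
      overfull {K} {p} {q} {r} mxK@(mtK , _) N⊆K Kp Kq Kr =
        1+n≰n (≤-trans (≤-reflexive (trans (≡-sym (proj₂ K⁺)) (trans (maximal-size (proj₁ K⁺) mxM) (trans |M| (≡-sym |L|)))))
                       (edgeCount-mono L⊆K))
        where
        K⁺ = maximal-plus-xy mxK
        adjK : ∀ {u v} → T (K u v) → Adj G u v
        adjK t = proj₁ (out⁻ G τ (proj₂ (edges mtK) _ _ t))
        p≢y' : p ≢ y'
        p≢y' refl = ¬x'y' (adjK Kp)
        p≢z' : p ≢ z'
        p≢z' refl = ¬x'z' (adjK Kp)
        q≢z' : q ≢ z'
        q≢z' refl = ¬y'z' (adjK Kq)
        L₁ = add x' p N
        L₂ = add y' q L₁
        L = add z' r L₂
        ¬y'₁ : ¬ T (L₁ y' q)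
        ¬y'₁ t = uncov-add ¬Ny' (≢-sym x'≢y') (≢-sym p≢y') (_ , t)
        ¬z'₂ : ¬ T (L₂ z' r)
        ¬z'₂ t = uncov-add (uncov-add ¬Nz' (≢-sym x'≢z') (≢-sym p≢z')) (≢-sym y'≢z') (≢-sym q≢z') (_ , t)
        E₀ = edges mtN
        E₁ = edgeSet-add G E₀ (adjK Kp)
        E₂ = edgeSet-add G E₁ (adjK Kq)
        grown : ∀ {a b F} → IsEdgeSet G F → T (K a b) → ¬ T (F a b) → edgeCount (add a b F) ≡ suc (edgeCount F)
        grown E t ¬ab = edgeCount-add (adj-irr G (adjK t)) ¬ab (¬ab ∘ edgeSet-sym G E)
        |L| : edgeCount L ≡ suc (suc (suc (edgeCount N)))
        |L| = trans (grown E₂ Kr ¬z'₂) (cong suc (trans (grown E₁ Kq ¬y'₁) (cong suc (grown E₀ Kp (λ t → ¬Nx' (_ , t))))))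
        grow : ∀ {a b F} → T (K a b) → F ⊆E K → add a b F ⊆E K
        grow ab s u v t with add⁻ t
        ... | inj₁ f = s u v f
        ... | inj₂ (inj₁ (refl , refl)) = ab
        ... | inj₂ (inj₂ (refl , refl)) = mate-sym R mtK ab
        L⊆K : L ⊆E K
        L⊆K = grow Kr (grow Kq (grow Kp N⊆K))
      absurd : ⊥
      absurd = let (K , mxK , N⊆K) = extend R mtR
               in overfull mxK N⊆K (Cover.edge (essX X K mxK)) (Cover.edge (essY Y K mxK)) (Cover.edge (essZ Z K mxK))

-- Exchanging edges in a minimal edge dominating set

opaque
  fromDec : ∀ {m} {P : Fin m → Fin m → Set} → (∀ u v → Dec (P u v)) → EdgeSet m
  fromDec P? u v = ⌊ P? u v ⌋

  fromDec⁻ : ∀ {m} {P : Fin m → Fin m → Set} (P? : ∀ u v → Dec (P u v)) {u v} → T (fromDec P? u v) → P u v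
  fromDec⁻ P? t = toWitness t

  fromDec⁺ : ∀ {m} {P : Fin m → Fin m → Set} (P? : ∀ u v → Dec (P u v)) {u v} → P u v → T (fromDec P? u v)
  fromDec⁺ P? p = fromWitness p

-- `F'` shrinks to a minimal edge dominating set, which has as many edges as `F`.
minimalEDS-least : ∀ {G} → WellEdgeDominated G → ∀ {F F'} → IsMinimalEDS G F →
  IsEdgeSet G F' → Dominating G F' → edgeCount F ≤ edgeCount F'
minimalEDS-least {G} wed {F} {F'} m E D =
  let (K , mK , K⊆F') = minimalEDS-in G F' E D
  in ≤-trans (≤-reflexive (wed F K m mK)) (edgeCount-mono K⊆F')

module _ {G : Graph} {τ : Fin (n G) → Bool} where

  private
    V = Fin (n G)
    R = Outside G τ
    Link = Linked G τ

  -- `meets` excludes vertices isolated in `R`, which places `b` in the component of `p` or of `q`.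
  record Confined (t p q b : V) : Set where
    field
      meets : Adj R b p ⊎ Adj R b q
      within : ∀ {v} → Adj R b v → v ≡ p ⊎ v ≡ q
      avoids : ¬ Adj G t b

  module Confinement {x y z} (S : Setup G τ x y z) {x' y'} (X : Link x x') (Y : Link y y')
                     (¬x'y' : ¬ Adj G x' y') where
    open Basics S

    Banned : V → Set
    Banned u = u ≡ x' ⊎ u ≡ y'

    banned? : ∀ u → Dec (Banned u)
    banned? u = u ≟ x' ⊎-dec u ≟ y'

    confined? : ∀ b → Dec ((Adj R b x' ⊎ Adj R b y') × (∀ v → Adj R b v → Banned v) × ¬ Adj G z b)
    confined? b = (T? _ ⊎-dec T? _) ×-dec (all? λ v → T? _ →-dec banned? v) ×-dec ¬? (T? _)

    -- Kept edges never cover x' or y', and can cover x and y only from z.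
    Kept : V → V → Set
    Kept u v = Adj G u v × ((u ≡ z ⊎ v ≡ z) ⊎ (Adj R u v × ¬ Banned u × ¬ Banned v))

    kept? : ∀ u v → Dec (Kept u v)
    kept? u v = T? _ ×-dec ((u ≟ z ⊎-dec v ≟ z) ⊎-dec (T? _ ×-dec ¬? (banned? u) ×-dec ¬? (banned? v)))

    F₀ : EdgeSet (n G)
    F₀ = fromDec kept?

    kept-sym : ∀ {u v} → Kept u v → Kept v u
    kept-sym (a , inj₁ p) = adj-sym G a , inj₁ (⊎-swap p)
    kept-sym (a , inj₂ (r , p , q)) = adj-sym G a , inj₂ (adj-sym R r , q , p)

    F₀-edges : IsEdgeSet G F₀
    F₀-edges = (λ u v → T-ext flip flip) , λ u v t → proj₁ (fromDec⁻ kept? t)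
      where
      flip : ∀ {u v} → T (F₀ u v) → T (F₀ v u)
      flip t = fromDec⁺ kept? (kept-sym (fromDec⁻ kept? t))

    at-z : ∀ {v} → Adj G z v → Cover F₀ v
    at-z zv = z , fromDec⁺ kept? (adj-sym G zv , inj₁ (inj₂ refl))

    banned-out : ∀ {u} → Banned u → ¬ T (τ u)
    banned-out (inj₁ refl) = proj₂ X
    banned-out (inj₂ refl) = proj₂ Y

    banned-≁z : ∀ {u} → Banned u → ¬ Adj G u z
    banned-≁z (inj₁ refl) x'z = Basics.disjoint (rot (rot S)) (adj-sym G x'z , proj₂ X) (proj₁ X)
    banned-≁z (inj₂ refl) y'z = Basics.disjoint (rot S) Y (adj-sym G y'z)

    banned-uncov : ∀ {F u} → F ⊆E F₀ → Banned u → ¬ Cover F u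
    banned-uncov s b (w , t) with fromDec⁻ kept? (s _ w t)
    ... | a , inj₁ (inj₁ refl)  = banned-out b τz
    ... | a , inj₁ (inj₂ refl)  = banned-≁z b a
    ... | a , inj₂ (_ , ¬b , _) = ¬b b

    triangle-mate : ∀ {F t} → F ⊆E F₀ → T (τ t) → t ≢ z → Cover F t → T (F t z)
    triangle-mate s τt t≢z (w , f) with fromDec⁻ kept? (s _ w f)
    ... | a , inj₁ (inj₁ e)    = ⊥-elim (t≢z e)
    ... | a , inj₁ (inj₂ refl) = f
    ... | a , inj₂ (r , _)     = ⊥-elim (proj₁ (proj₂ (out⁻ G τ r)) τt)

    triangle-covered : ∀ {u} → u ∈₃ (x , y , z) → Cover F₀ u
    triangle-covered (inj₁ refl)        = at-z (adj-sym G xz)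
    triangle-covered (inj₂ (inj₁ refl)) = at-z (adj-sym G yz)
    triangle-covered (inj₂ (inj₂ refl)) = x , fromDec⁺ kept? (adj-sym G xz , inj₁ (inj₁ refl))

    both-banned : ∀ {u v} → Banned u → Banned v → ¬ Adj G u v
    both-banned (inj₁ refl) (inj₁ refl) a = adj-irr G a refl
    both-banned (inj₁ refl) (inj₂ refl) a = ¬x'y' a
    both-banned (inj₂ refl) (inj₁ refl) a = ¬x'y' (adj-sym G a)
    both-banned (inj₂ refl) (inj₂ refl) a = adj-irr G a refl

    module _ (none : ¬ ∃ λ b → (Adj R b x' ⊎ Adj R b y') × (∀ v → Adj R b v → Banned v) × ¬ Adj G z b) where

      -- The absence of a confined vertex enters here: `u` has a neighbour in `R` that is not banned
      -- or is adjacent to `z`, and either gives a kept edge at `u`.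
      beside-banned : ∀ {u v} → Adj R u v → Banned v → Cover F₀ u
      beside-banned {u} {v} uv bv
        with any? (λ w → T? (adj R u w) ×-dec ¬? (banned? w)) | T? (adj G z u)
      ... | yes (w , uw , ¬bw) | _ =
        w , fromDec⁺ kept? (proj₁ (out⁻ G τ uw) , inj₂ (uw , (λ bu → both-banned bu bv (proj₁ (out⁻ G τ uv))) , ¬bw))
      ... | _      | yes zu = at-z zu
      ... | no ¬w  | no ¬zu = ⊥-elim (none (u ,
              [ (λ { refl → inj₁ uv }) , (λ { refl → inj₂ uv }) ]′ bv ,
              (λ w uw → decidable-stable (banned? w) λ ¬bw → ¬w (w , uw , ¬bw)) , ¬zu))

      F₀-dominating : Dominating G F₀
      F₀-dominating u v uv with T? (τ u) | T? (τ v) | banned? u | banned? v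
      ... | yes τu | _ | _ | _ = inj₁ (triangle-covered (τ⁻ τu))
      ... | _ | yes τv | _ | _ = inj₂ (triangle-covered (τ⁻ τv))
      ... | no p | no q | yes bu | _ = inj₂ (beside-banned (out⁺ G τ (adj-sym G uv) q p) bu)
      ... | no p | no q | _ | yes bv = inj₁ (beside-banned (out⁺ G τ uv p q) bv)
      ... | no p | no q | no bu | no bv = inj₁ (v , fromDec⁺ kept? (uv , inj₂ (out⁺ G τ uv p q , bu , bv)))

      -- Exchanging zx and zy for xy in a minimal edge dominating set makes it smaller.
      exchange : ∀ {F} → IsMinimalEDS G F → F ⊆E F₀ → ⊥
      exchange {F} mF@(edsF@(EF , _) , _) F⊆ =
        1+n≰n (≤-trans (≤-reflexive (trans (cong suc |F'|) (≡-sym |F|))) (minimalEDS-least {G} wed mF EF' F'-dominating))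
        where
        domF = EDS⇒dominating G edsF
        must : ∀ {u v} → Adj G u v → ¬ Cover F v → Cover F u
        must uv ¬v = [ id , ⊥-elim ∘ ¬v ]′ (domF _ _ uv)
        -- The edge `xx'` must be dominated at `x`, since `x'` is uncovered, and within `F₀` only
        -- `xz` covers `x`.
        Fxz : T (F x z)
        Fxz = triangle-mate F⊆ τx x≢z (must (proj₁ X) (banned-uncov F⊆ (inj₁ refl)))
        Fyz : T (F y z)
        Fyz = triangle-mate F⊆ τy y≢z (must (proj₁ Y) (banned-uncov F⊆ (inj₂ refl)))
        D₁ = rem x z F
        D = rem y z D₁
        F' = add x y D
        ED₁ = edgeSet-rem G {a = x} {z} EF
        ED = edgeSet-rem G {a = y} {z} ED₁
        EF' = edgeSet-add G ED xy
        D₁yz : T (D₁ y z)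
        D₁yz = rem⁺ {F = F} Fyz λ { (inj₁ (p , _)) → x≢y (≡-sym p) ; (inj₂ (p , _)) → y≢z p }
        |F| : edgeCount F ≡ suc (suc (edgeCount D))
        |F| = trans (edgeCount-rem x≢z Fxz (edgeSet-sym G EF Fxz)) (cong suc (edgeCount-rem y≢z D₁yz (edgeSet-sym G ED₁ D₁yz)))
        D⊆F₀ : D ⊆E F₀
        D⊆F₀ u v t = F⊆ u v (rem-⊆ u v (rem-⊆ u v t))
        -- An edge `xy` in `D` would cover `x`, hence force `xz` into `D`, from which it was
        -- removed.
        ¬Dxy : ¬ T (D x y)
        ¬Dxy t = proj₂ (rem⁻ (rem-⊆ _ _ Dxz)) (inj₁ (refl , refl))
          where Dxz = triangle-mate D⊆F₀ τx x≢z (y , t)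
        |F'| : edgeCount F' ≡ suc (edgeCount D)
        |F'| = edgeCount-add x≢y ¬Dxy (¬Dxy ∘ edgeSet-sym G ED)
        out-covered : ∀ {v} → ¬ T (τ v) → Cover F v → Cover F' v
        out-covered p c = cover-add⁺ (cover-rem G (cover-rem G c (out≢ p τx) (out≢ p τz)) (out≢ p τy) (out≢ p τz))
        -- A link of `z` missed by `F` cannot be adjacent to `x'` or `y'`, which `F` also misses;
        -- the three links would be independent.
        z-links : ∀ {v} → Link z v → Cover F v
        z-links {v} Z@(zv , _) = decidable-stable (cover? F v) λ ¬v →
          Structure.no-independent-links S X Y Z ¬x'y'
            (λ a → banned-uncov F⊆ (inj₂ refl) (must a ¬v))
            (λ a → banned-uncov F⊆ (inj₁ refl) (must a ¬v))
        keep : ∀ {u v} → Adj G u v → Cover F u → Cover F' u ⊎ Cover F' v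
        keep {u} {v} uv c with T? (τ u)
        ... | no p = inj₁ (out-covered p c)
        ... | yes τu with τ⁻ τu
        ...   | inj₁ refl        = inj₁ cover-addˡ
        ...   | inj₂ (inj₁ refl) = inj₁ cover-addʳ
        ...   | inj₂ (inj₂ refl) with T? (τ v)
        ...     | no p = inj₂ (out-covered p (z-links (uv , p)))
        ...     | yes τv with τ⁻ τv
        ...       | inj₁ refl        = inj₂ cover-addˡ
        ...       | inj₂ (inj₁ refl) = inj₂ cover-addʳ
        ...       | inj₂ (inj₂ refl) = ⊥-elim (adj-irr G uv refl)
        F'-dominating : Dominating G F'
        F'-dominating u v uv = [ keep uv , ⊎-swap ∘ keep (adj-sym G uv) ]′ (domF u v uv)

    opaque
      confined : ∃ (Confined z x' y')
      confined = let (b , m , w , a) = decidable-stable (any? confined?) λ none →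
                       let (F , mF , F⊆) = minimalEDS-in G F₀ F₀-edges (F₀-dominating none)
                       in exchange none mF F⊆
                 in b , record { meets = m ; within = w _ ; avoids = a }

-- Recognising the crystal graph

-- Makes every adjacency-preserving labelling of vertices by those of Cr injective.
cr-rows : ∀ i j → (∀ k → crAdj i k ≡ crAdj j k) → i ≡ j
cr-rows = toWitness {a? = all? λ i → all? λ j → (all? λ k → crAdj i k ≟ᵇ crAdj j k) →-dec (i ≟ j)} _

-- The entries above the diagonal fix the whole table by symmetry. Vertices with the same image
-- under `f` have equal rows in `Cr`, so `f` is injective and its section `to` is a bijection.
labelling⇒≅Cr : ∀ {G} (f : Fin 7 → Fin (n G)) → (∀ v → ∃ λ i → f i ≡ v) →
  (∀ i j → i <ᶠ j → adj G (f i) (f j) ≡ crAdj i j) → G ≅ Cr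
labelling⇒≅Cr {G} f surj upper = mk⤖ {to = to} (to-injective , λ i → f i , λ { refl → f-injective (f∘to (f i)) }) ,
  λ u v → trans (≡-sym (cong₂ (adj G) (f∘to u) (f∘to v))) (all (to u) (to v))
  where
  to : Fin (n G) → Fin 7
  to v = proj₁ (surj v)
  f∘to : ∀ v → f (to v) ≡ v
  f∘to v = proj₂ (surj v)
  all : ∀ i j → adj G (f i) (f j) ≡ crAdj i j
  all i j with <-cmp i j
  ... | tri< i<j _ _ = upper i j i<j
  ... | tri≈ _ refl _ = trans (irrefl G (f i)) (≡-sym (crIrrefl i))
  ... | tri> _ _ j<i = trans (Graph.sym G (f i) (f j)) (trans (upper j i j<i) (Graph.sym Cr j i))
  f-injective : ∀ {i j} → f i ≡ f j → i ≡ j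
  f-injective {i} {j} e = cr-rows i j λ k →
    trans (≡-sym (all i k)) (trans (cong (λ v → adj G v (f k)) e) (all j k))
  to-injective : ∀ {u v} → to u ≡ to v → u ≡ v
  to-injective {u} {v} e = trans (≡-sym (f∘to u)) (trans (cong f e) (f∘to v))

module _ {G : Graph} {τ : Fin (n G) → Bool} where

  private
    V = Fin (n G)
    R = Outside G τ
    Link = Linked G τ

  -- The walk is followed to its first triangle vertex `t`. That `t` is not avoided is recorded so
  -- that, in `G` without `x` and `y`, it can only be `z`.
  first-entry : ∀ {av u w} → WalkAvoiding G av u w → ¬ T (τ u) → T (τ w) →
    ∃[ s ] ∃[ t ] (Star (Adj R) u s × Link t s × T (τ t) × av t ≡ false)
  first-entry (stay _) p q = ⊥-elim (p q)
  first-entry {u = u} (step {v = v} _ uv r) p q with T? (τ v)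
  ... | yes τv = u , v , ε , (adj-sym G uv , p) , τv , start r
    where
    start : ∀ {av u w} → WalkAvoiding G av u w → av u ≡ false
    start (stay e)     = e
    start (step e _ _) = e
  ... | no ¬τv = let (s , t , path , rest) = first-entry r ¬τv q
                 in s , t , (out⁺ G τ uv p ¬τv ◅ path) , rest

  -- If x had a second link s, then xs, zz', yy', x'b could be completed to a maximal matching, in
  -- which x'y' may replace both yy' and x'b.
  link-unique : ∀ {x y z} (S : Setup G τ x y z) {x' y' z' b} → Link x x' → Link y y' → Link z z' →
    Adj G x' y' → Adj G x' b → ¬ T (τ b) →
    (∀ {s} → Link y s → s ≡ y') →
    (∀ {v} → Adj R b v → v ≡ x' ⊎ v ≡ z') →
    (∀ {t} → T (τ t) → ¬ Adj G t b) →
    ∀ {s} → Link x s → s ≡ x'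
  link-unique {x} {y} {z} S {x'} {y'} {z'} {b} X@(xx' , ¬τx') Y@(yy' , ¬τy') Z@(zz' , ¬τz') x'y' x'b ¬τb uniqueY Nb far {s} X₁@(xs , ¬τs) =
    decidable-stable (s ≟ x') absurd
    where
    open Basics S
    absurd : s ≢ x' → ⊥
    absurd s≢x' = let (M , mx , s) = extend G mt₄ in
      smaller mx (s _ _ (add-⊇ _ _ (add-⊇ _ _ (add-⊇ _ _ (add-new {F = ∅})))))
                 (s _ _ (add-⊇ _ _ (add-⊇ _ _ (add-new {F = M₁}))))
                 (s _ _ (add-⊇ _ _ (add-new {F = M₂})))
                 (s _ _ (add-new {F = M₃}))
      where
      b≢y' : b ≢ y'
      b≢y' refl = far τy yy'
      y'≢x' : y' ≢ x'
      y'≢x' = ≢-sym (adj-irr G x'y')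
      z'≢x' : z' ≢ x'
      z'≢x' refl = Basics.disjoint (rot (rot S)) Z xx'
      z'≢b : z' ≢ b
      z'≢b refl = far τz zz'
      z'≢y' : z' ≢ y'
      z'≢y' refl = Basics.disjoint (rot S) Y zz'
      s≢b : s ≢ b
      s≢b refl = far τx xs
      s≢y' : s ≢ y'
      s≢y' refl = disjoint X₁ yy'
      s≢z' : s ≢ z'
      s≢z' refl = Basics.disjoint (rot (rot S)) Z xs
      τ≢ : ∀ {t u} → T (τ t) → ¬ T (τ u) → t ≢ u
      τ≢ p q = ≢-sym (out≢ q p)
      M₁ = add x' b ∅
      M₂ = add y y' M₁
      M₃ = add z z' M₂
      mt₁ = matching-add G (matching-∅ G) x'b (λ ()) (λ ())
      mt₂ = matching-add G mt₁ yy' (uncov-add (λ ()) (τ≢ τy ¬τx') (τ≢ τy ¬τb))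
                                   (uncov-add (λ ()) y'≢x' (≢-sym b≢y'))
      mt₃ = matching-add G mt₂ zz' (uncov-add (uncov-add (λ ()) (τ≢ τz ¬τx') (τ≢ τz ¬τb)) (≢-sym y≢z) (τ≢ τz ¬τy'))
                                   (uncov-add (uncov-add (λ ()) z'≢x' z'≢b) (out≢ ¬τz' τy) z'≢y')
      mt₄ = matching-add G mt₃ xs
        (uncov-add (uncov-add (uncov-add (λ ()) (τ≢ τx ¬τx') (τ≢ τx ¬τb)) x≢y (τ≢ τx ¬τy')) x≢z (τ≢ τx ¬τz'))
        (uncov-add (uncov-add (uncov-add (λ ()) s≢x' s≢b) (out≢ ¬τs τy) s≢y') (out≢ ¬τs τz) s≢z')
      smaller : ∀ {M} → Maximal G M → T (M x' b) → T (M y y') → T (M z z') → T (M x s) → ⊥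
      smaller {M} mx@(mt , dom) Mx'b Myy' Mzz' Mxs =
        1+n≢n (trans (≡-sym |M|) (trans (maximal-size mx (mt' , dom')) |M'|))
        where
        N = rem x' b M
        mtN = matching-rem G {a = x'} {b} mt
        Nyy' : T (N y y')
        Nyy' = rem⁺ {F = M} Myy' λ { (inj₁ (p , _)) → out≢ ¬τx' τy (≡-sym p) ; (inj₂ (p , _)) → out≢ ¬τb τy (≡-sym p) }
        K = rem y y' N
        ¬Kx' : ¬ Cover K x'
        ¬Kx' = uncov-remˡ G mt Mx'b ∘ cover-⊆ rem-⊆
        ¬Ky' : ¬ Cover K y'
        ¬Ky' = uncov-remʳ G mtN Nyy'
        M' = add x' y' K
        mt' : Matching G M'
        mt' = matching-add G (matching-rem G mtN) x'y' ¬Kx' ¬Ky'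
        |M'| : edgeCount M' ≡ suc (edgeCount K)
        |M'| = |matching-add| G x'y' ¬Kx' ¬Ky'
        |M| : edgeCount M ≡ suc (suc (edgeCount K))
        |M| = trans (|matching-rem| G mt Mx'b) (cong suc (|matching-rem| G mtN Nyy'))
        -- Only `y` and `b` lose their mates, so it remains to see that all their neighbours are
        -- covered by `M'`.
        keep : ∀ {u} → u ≢ y → u ≢ b → Cover M u → Cover M' u
        keep {u} u≢y u≢b c with u ≟ x' | u ≟ y'
        ... | yes refl | _ = cover-addˡ
        ... | _ | yes refl = cover-addʳ
        ... | no u≢x' | no u≢y' = cover-add⁺ (cover-rem G (cover-rem G c u≢x' u≢b) u≢y u≢y')
        beside-y : ∀ {v} → Adj G y v → Cover M' v
        beside-y {v} yv with T? (τ v)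
        ... | no ¬τv with refl ← uniqueY (yv , ¬τv) = cover-addʳ
        ... | yes τv with τ⁻ τv
        ...   | inj₁ refl        = keep x≢y (τ≢ τx ¬τb) (_ , Mxs)
        ...   | inj₂ (inj₁ refl) = ⊥-elim (adj-irr G yv refl)
        ...   | inj₂ (inj₂ refl) = keep (≢-sym y≢z) (τ≢ τz ¬τb) (_ , Mzz')
        beside-b : ∀ {v} → Adj G b v → Cover M' v
        beside-b {v} bv with T? (τ v)
        ... | yes τv = ⊥-elim (far τv (adj-sym G bv))
        ... | no ¬τv with Nb (out⁺ G τ bv ¬τb ¬τv)
        ...   | inj₁ refl = cover-addˡ
        ...   | inj₂ refl = keep (out≢ ¬τz' τy) z'≢b (_ , mate-sym G mt Mzz')
        dom' : Dominating G M'
        dom' u v uv with u ≟ y | u ≟ b | v ≟ y | v ≟ b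
        ... | yes refl | _ | _ | _ = inj₂ (beside-y uv)
        ... | _ | yes refl | _ | _ = inj₂ (beside-b uv)
        ... | _ | _ | yes refl | _ = inj₁ (beside-y (adj-sym G uv))
        ... | _ | _ | _ | yes refl = inj₁ (beside-b (adj-sym G uv))
        ... | no p | no q | no p' | no q' = [ inj₁ ∘ keep p q , inj₂ ∘ keep p' q' ]′ (dom u v uv)

  -- With y' = u₁, x' = u₂, b = u₃, z' = u₄ and x, y, z = t₁, t₂, t₃ this is the labelling of Cr.
  crystal : ∀ {x y z} → Setup G τ x y z → Connected G → ∀ {x' y' z'} →
    Link x x' → Link y y' → Link z z' → Adj G x' y' → Adj G y' z' → G ≅ Cr
  crystal {x} {y} {z} S conn {x'} {y'} {z'} X@(xx' , ¬τx') Y@(yy' , ¬τy') Z@(zz' , ¬τz') x'y' y'z' =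
    -- The relabelled triangle is `x`, `z`, `y`: the vertex `b` is confined to `x'`, `z'` and not
    -- adjacent to `y`.
    labelled (Confinement.confined (swp (rot (rot S))) X Z ¬x'z')
    where
    open Basics S
    open Structure S
    open EquimatchableTriangleFree outside-equimatchable outside-triangleFree
    x'~y' : Adj R x' y'
    x'~y' = out⁺ G τ x'y' ¬τx' ¬τy'
    y'~z' : Adj R y' z'
    y'~z' = out⁺ G τ y'z' ¬τy' ¬τz'
    ¬x'z' : ¬ Adj G x' z'
    ¬x'z' x'z' = outside-triangleFree x' y' z' x'~y' y'~z' (out⁺ G τ x'z' ¬τx' ¬τz')
    x'≢z' : x' ≢ z'
    x'≢z' refl = Basics.disjoint (rot (rot S)) Z xx'
    labelled : ∃ (Confined y x' z') → G ≅ Cr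
    labelled (b , conf) = labelling⇒≅Cr {G} f onto table
      where
      open Confined conf renaming (within to Nb)
      b≢y' : b ≢ y'
      b≢y' refl = avoids yy'
      sq = square (essX X) (essY Y) (essZ Z) x'~y' y'~z' x'≢z' meets Nb b≢y'
      open Square sq
      ¬τb : ¬ T (τ b)
      ¬τb = proj₁ (proj₂ (out⁻ G τ bp))
      x'b : Adj G x' b
      x'b = adj-sym G (proj₁ (out⁻ G τ bp))
      bz' : Adj G b z'
      bz' = proj₁ (out⁻ G τ br)
      -- An edge from `x` or `z` to `b` would close a second triangle, through `x'` or `z'`.
      far : ∀ {t} → T (τ t) → ¬ Adj G t b
      far τt tb with τ⁻ τt
      ... | inj₁ refl        = ¬τx' (only _ _ _ x'b (adj-sym G tb) (adj-sym G xx'))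
      ... | inj₂ (inj₁ refl) = avoids tb
      ... | inj₂ (inj₂ refl) = ¬τz' (only _ _ _ (adj-sym G bz') (adj-sym G tb) (adj-sym G zz'))
      -- A second link of `y` is neither `y'` nor `b`, hence adjacent to neither `x'` nor `z'`,
      -- which gives three independent links.
      uniqueY : ∀ {s} → Link y s → s ≡ y'
      uniqueY {s} Y₁@(ys , ¬τs) = decidable-stable (s ≟ y') λ s≢y' →
        let not-corner : ¬ (s ≡ y' ⊎ s ≡ b)
            not-corner = [ s≢y' , (λ e → avoids (subst (Adj G y) e ys)) ]′
        in no-independent-links X Y₁ Z
             (λ a → not-corner (Np (out⁺ G τ a ¬τx' ¬τs)))
             (λ a → not-corner (Nr (out⁺ G τ (adj-sym G a) ¬τz' ¬τs)))
             ¬x'z'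
      uniqueX : ∀ {s} → Link x s → s ≡ x'
      uniqueX = link-unique S X Y Z x'y' x'b ¬τb uniqueY Nb far
      uniqueZ : ∀ {s} → Link z s → s ≡ z'
      uniqueZ = link-unique (swp (rot S)) Z Y X (adj-sym G y'z') (adj-sym G bz') ¬τb uniqueY
                            (⊎-swap ∘ Nb) far

      f : Fin 7 → V
      f 0F = x
      f 1F = y
      f 2F = z
      f 3F = y'
      f 4F = x'
      f 5F = b
      f 6F = z'

      Corner : V → Set
      Corner v = (v ≡ y' ⊎ v ≡ x') ⊎ (v ≡ b ⊎ v ≡ z')
      back : ∀ {u v} → Adj R u v → Corner v → Corner u
      back a (inj₁ (inj₁ refl)) = [ inj₁ ∘ inj₂ , inj₂ ∘ inj₂ ]′ (Nq (adj-sym R a))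
      back a (inj₁ (inj₂ refl)) = [ inj₁ ∘ inj₁ , inj₂ ∘ inj₁ ]′ (Np (adj-sym R a))
      back a (inj₂ (inj₁ refl)) = [ inj₁ ∘ inj₂ , inj₂ ∘ inj₂ ]′ (Nb (adj-sym R a))
      back a (inj₂ (inj₂ refl)) = [ inj₁ ∘ inj₁ , inj₂ ∘ inj₁ ]′ (Nr (adj-sym R a))
      link-corner : ∀ {t s} → T (τ t) → Link t s → Corner s
      link-corner τt L with τ⁻ τt
      ... | inj₁ refl        = inj₁ (inj₂ (uniqueX L))
      ... | inj₂ (inj₁ refl) = inj₁ (inj₁ (uniqueY L))
      ... | inj₂ (inj₂ refl) = inj₂ (inj₂ (uniqueZ L))
      onto : ∀ v → ∃ λ i → f i ≡ v
      onto v with T? (τ v)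
      ... | yes τv = inside (τ⁻ τv)
        where
        inside : v ∈₃ (x , y , z) → ∃ λ i → f i ≡ v
        inside (inj₁ e)        = 0F , ≡-sym e
        inside (inj₂ (inj₁ e)) = 1F , ≡-sym e
        inside (inj₂ (inj₂ e)) = 2F , ≡-sym e
      -- By connectedness `v` reaches a link inside `R`; links are corners, and corners are closed
      -- under adjacency in `R`.
      ... | no ¬τv = corner-index (let (s , t , path , L , τt , _) = first-entry (conn v x) ¬τv τx
                                   in closed-backward Corner back path (link-corner τt L))
        where
        corner-index : Corner v → ∃ λ i → f i ≡ v
        corner-index (inj₁ (inj₁ e)) = 3F , ≡-sym e
        corner-index (inj₁ (inj₂ e)) = 4F , ≡-sym e
        corner-index (inj₂ (inj₁ e)) = 5F , ≡-sym e
        corner-index (inj₂ (inj₂ e)) = 6F , ≡-sym e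

      + : ∀ {u v} → Adj G u v → adj G u v ≡ true
      + = Equivalence.to T-≡
      - : ∀ {u v} → ¬ Adj G u v → adj G u v ≡ false
      - = ¬T⇒false
      ¬y'b : ¬ Adj G y' b
      ¬y'b a with Nq (out⁺ G τ a ¬τy' ¬τb)
      ... | inj₁ e = adj-irr R bp e
      ... | inj₂ e = adj-irr R br e

      table : ∀ i j → i <ᶠ j → adj G (f i) (f j) ≡ crAdj i j
      table 0F 1F _ = + xy
      table 0F 2F _ = + xz
      table 0F 3F _ = - λ xy' → disjoint (xy' , ¬τy') yy'
      table 0F 4F _ = + xx'
      table 0F 5F _ = - (far τx)
      table 0F 6F _ = - (Basics.disjoint (rot (rot S)) Z)
      table 1F 2F _ = + yz
      table 1F 3F _ = + yy'
      table 1F 4F _ = - (disjoint X)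
      table 1F 5F _ = - (far τy)
      table 1F 6F _ = - λ yz' → Basics.disjoint (rot S) (yz' , ¬τz') zz'
      table 2F 3F _ = - (Basics.disjoint (rot S) Y)
      table 2F 4F _ = - λ zx' → Basics.disjoint (rot (rot S)) (zx' , ¬τx') xx'
      table 2F 5F _ = - (far τz)
      table 2F 6F _ = + zz'
      table 3F 4F _ = + (adj-sym G x'y')
      table 3F 5F _ = - ¬y'b
      table 3F 6F _ = + y'z'
      table 4F 5F _ = + x'b
      table 4F 6F _ = - ¬x'z'
      table 5F 6F _ = + bz'
      table (suc _) 1F (s≤s ())
      table (suc (suc _)) 2F (s≤s (s≤s ()))
      table (suc (suc (suc _))) 3F (s≤s (s≤s (s≤s ())))
      table (suc (suc (suc (suc _)))) 4F (s≤s (s≤s (s≤s (s≤s ()))))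
      table (suc (suc (suc (suc (suc _))))) 5F (s≤s (s≤s (s≤s (s≤s (s≤s ())))))
      table (suc (suc (suc (suc (suc (suc _)))))) 6F (s≤s (s≤s (s≤s (s≤s (s≤s (s≤s ()))))))

-- Finding a path of three links

module _ {G : Graph} {τ : Fin (n G) → Bool} where

  private
    V = Fin (n G)
    R = Outside G τ
    Link = Linked G τ

  -- Every nontrivial component of `R` contains a link of `z`; the edge `vu` witnesses that the
  -- component of `v` is nontrivial.
  LinkReachable : V → Set
  LinkReachable z = ∀ {v u} → Adj R v u → ∃[ s ] (Link z s × Star (Adj R) v s)

  -- The component of `x'y'` contains a link `z'` of `z`. If `z'` is adjacent to neither, the
  -- vertices confined to `x'`, `z'` and to `y'`, `z'` contradict `no-split-leaf`.
  crystal-of-adjacent-links : ∀ {x y z} → Setup G τ x y z → Connected G → LinkReachable z →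
    ∀ {x' y'} → Link x x' → Link y y' → Adj G x' y' → G ≅ Cr
  crystal-of-adjacent-links {x} {y} {z} S conn reach {x'} {y'} X@(xx' , ¬τx') Y@(yy' , ¬τy') x'y' =
    case (reach x'~y')
    where
    open Basics S
    open Structure S
    open EquimatchableTriangleFree outside-equimatchable outside-triangleFree
    x'~y' : Adj R x' y'
    x'~y' = out⁺ G τ x'y' ¬τx' ¬τy'
    case : ∃[ z' ] (Link z z' × Star (Adj R) x' z') → G ≅ Cr
    case (z' , Z@(zz' , ¬τz') , path) with T? (adj G x' z') | T? (adj G y' z')
    ... | yes x'z' | _ = crystal (swp S) conn Y X Z (adj-sym G x'y') x'z'
    ... | _ | yes y'z' = crystal S conn X Y Z x'y' y'z'
    ... | no ¬x'z' | no ¬y'z' = ⊥-elim (split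
            (Confinement.confined (swp (rot (rot S))) X Z ¬x'z')
            (Confinement.confined (rot S) Y Z ¬y'z'))
      where
      x'≢z' : x' ≢ z'
      x'≢z' refl = Basics.disjoint (rot (rot S)) Z xx'
      split : ∃ (Confined y x' z') → ∃ (Confined x y' z') → ⊥
      split (b , c) (b' , c') = no-split-leaf (essX X) (essY Y) x'~y' path x'≢z' (¬x'z' ∘ proj₁ ∘ out⁻ G τ)
        (meets c) (within c) (λ { refl → avoids c yy' })
        (meets c') (within c') (λ { refl → avoids c' xx' })
        where open Confined

  -- If `z'` is not adjacent to `y'`, take `b` confined to `x'`, `y'`. When `b` meets `x'`,
  -- `no-side-path` applies; otherwise `b` is a leaf at `y'`, and the link of `z` reachable from
  -- `y'` fits neither in a component with just `y'` and `b` nor among independent links.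
  crystal-of-nonadjacent-links : ∀ {x y z} → Setup G τ x y z → Connected G → LinkReachable z →
    (∀ {x' y'} → Link x x' → Link y y' → ¬ Adj G x' y') →
    ∀ {x' y' z'} → Link x x' → Link y y' → Link z z' → Adj G x' z' → G ≅ Cr
  crystal-of-nonadjacent-links {x} {y} {z} S conn reach apart {x'} {y'} {z'} X@(xx' , ¬τx') Y@(yy' , ¬τy') Z@(zz' , ¬τz') x'z'
    with T? (adj G z' y')
  ... | yes z'y' = crystal (swp (rot (rot S))) conn X Z Y x'z' z'y'
  ... | no ¬z'y' = ⊥-elim (contra (Confinement.confined S X Y ¬x'y'))
    where
    open Basics S
    open Structure S
    open EquimatchableTriangleFree outside-equimatchable outside-triangleFree
    ¬x'y' : ¬ Adj G x' y'
    ¬x'y' = apart X Y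
    inside⁻ : ∀ {u v} → Adj R u v → Adj G u v
    inside⁻ = proj₁ ∘ out⁻ G τ
    contra : ¬ ∃ (Confined z x' y')
    contra (b , record { meets = meets ; within = Nb ; avoids = ¬zb }) with T? (adj R b x')
    ... | yes bx' = no-side-path (essX X) (essZ Z) (essY Y) (out⁺ G τ x'z' ¬τx' ¬τz')
                      (¬z'y' ∘ inside⁻) (¬x'y' ∘ inside⁻) bx' Nb (λ { refl → ¬zb zz' })
    ... | no ¬bx' = leaf (reach (adj-sym R by'))
      where
      by' : Adj R b y'
      by' = [ ⊥-elim ∘ ¬bx' , id ]′ meets
      leaf-at : ∀ {v} → Adj R b v → v ≡ y'
      leaf-at bv = [ (λ { refl → ⊥-elim (¬bx' bv) }) , id ]′ (Nb bv)
      x'≢b : x' ≢ b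
      x'≢b refl = ¬x'y' (inside⁻ by')
      x'≢y' : x' ≢ y'
      x'≢y' refl = disjoint X yy'
      leaf : ¬ (∃[ z₁ ] (Link z z₁ × Star (Adj R) y' z₁))
      leaf (z₁ , Z₁@(zz₁ , ¬τz₁) , path) with T? (adj R z₁ y') | T? (adj R z₁ x')
      ... | yes z₁y' | _ =
        [ (λ { refl → adj-irr R z₁y' refl }) , (λ { refl → ¬zb zz₁ }) ]′
          (leaf-component (spread (essZ Z₁) (essY Y) z₁y' (adj-sym R by')) by' leaf-at (z₁y' ◅ ε))
      ... | _ | yes z₁x' =
        [ x'≢y' , x'≢b ]′
          (leaf-component (spread* (essZ Z₁) (essX X) z₁x' (x'→y' ◅◅ (adj-sym R by' ◅ ε))) by' leaf-at x'→y')
        where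
        x'→y' : Star (Adj R) x' y'
        x'→y' = adj-sym R z₁x' ◅ reverse (adj-sym R) path
      ... | no ¬z₁y' | no ¬z₁x' = no-independent-links X Y Z₁ ¬x'y'
        (λ a → ¬z₁y' (out⁺ G τ (adj-sym G a) ¬τz₁ ¬τy'))
        (λ a → ¬z₁x' (out⁺ G τ (adj-sym G a) ¬τz₁ ¬τx'))

  -- An adjacent pair of links of `x` and `y` is sought first. Failing that, `no-independent-links`
  -- makes `z'` adjacent to `x'` or `y'`.
  crystal-of-links : ∀ {x y z} → Setup G τ x y z → Connected G → LinkReachable z →
    ∀ {x' y' z'} → Link x x' → Link y y' → Link z z' → G ≅ Cr
  crystal-of-links {x} {y} {z} S conn reach {x'} {y'} {z'} X Y Z
    with any? (λ p → any? λ q → link? x p ×-dec link? y q ×-dec T? (adj G p q))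
    where
    link? : ∀ t s → Dec (Link t s)
    link? t s = T? (adj G t s) ×-dec ¬? (T? (τ s))
  ... | yes (p , q , P , Q , pq) = crystal-of-adjacent-links S conn reach P Q pq
  ... | no none with T? (adj G x' z') | T? (adj G y' z')
  ...   | yes x'z' | _ = crystal-of-nonadjacent-links S conn reach (λ P Q pq → none (_ , _ , P , Q , pq)) X Y Z x'z'
  ...   | _ | yes y'z' = crystal-of-nonadjacent-links (swp S) conn reach
                           (λ P Q pq → none (_ , _ , Q , P , adj-sym G pq)) Y X Z y'z'
  ...   | no ¬x'z' | no ¬y'z' = ⊥-elim (Structure.no-independent-links S X Y Z
                                  (λ a → none (_ , _ , X , Y , a)) ¬y'z' ¬x'z')

  -- Links from the degree and component hypotheses

  removed-false : ∀ {x y u} → u ≢ x → u ≢ y → removed G x y u ≡ false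
  removed-false {x} {y} {u} p q with u ≟ x | u ≟ y
  ... | yes e | _     = ⊥-elim (p e)
  ... | no _  | yes e = ⊥-elim (q e)
  ... | no _  | no _  = refl

  not-removed : ∀ {x y u} → removed G x y u ≡ false → u ≢ x × u ≢ y
  not-removed {x} {y} {u} r with u ≟ x | u ≟ y
  ... | no p | no q = p , q

  -- Both `vu` and `zz'` are edges of `G` without `x` and `y`, so a walk there joins `v` to `z`; its
  -- first triangle vertex is `z`, entered from a link.
  one-component⇒linkReachable : ∀ {x y z z'} → Setup G τ x y z → Link z z' →
    ExactlyOneNontrivialComponent G x y → LinkReachable z
  one-component⇒linkReachable {x} {y} {z} {z'} S (zz' , ¬τz') (_ , joined) {v} {u} vu =
    let (a , ¬τv , ¬τu) = out⁻ G τ vu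
        (s , t , path , L , τt , kept) = first-entry
          (joined v u z z' (outside ¬τv , outside ¬τu , a)
                           (removed-false (≢-sym x≢z) (≢-sym y≢z) , outside ¬τz' , zz')) ¬τv τz
    in s , subst (λ t → Link t s) (is-z (τ⁻ τt) kept) L , path
    where
    open Basics S
    outside : ∀ {u} → ¬ T (τ u) → removed G x y u ≡ false
    outside p = removed-false (out≢ p τx) (out≢ p τy)
    is-z : ∀ {t} → t ∈₃ (x , y , z) → removed G x y t ≡ false → t ≡ z
    is-z (inj₁ e) r        = ⊥-elim (proj₁ (not-removed r) e)
    is-z (inj₂ (inj₁ e)) r = ⊥-elim (proj₂ (not-removed r) e)
    is-z (inj₂ (inj₂ e)) r = e

  degree⇒link : ∀ {x y z} → Setup G τ x y z → degree G x ≥ 3 → ∃ (Link x)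
  degree⇒link {x} {y} {z} S d = decidable-stable (any? λ s → T? (adj G x s) ×-dec ¬? (T? (τ s))) λ none →
    1+n≰n (≤-trans d (count-pair y≢z λ s xs → others xs (decidable-stable (T? (τ s)) λ ¬τs → none (s , xs , ¬τs))))
    where
    open Basics S
    others : ∀ {s} → Adj G x s → T (τ s) → s ≡ y ⊎ s ≡ z
    others xs τs with τ⁻ τs
    ... | inj₁ refl = ⊥-elim (adj-irr G xs refl)
    ... | inj₂ e    = e

theorem10 : (G : Graph) → (x y z : Fin' G) →
    Connected G → WellEdgeDominated G → UniqueTriangle G x y z →
    ExactlyOneNontrivialComponent G x y →
    degree G x ≥ 3 → degree G y ≥ 3 → degree G z ≥ 3 →
    G ≅ Cr
theorem10 G x y z conn wed ((x≢y , y≢z , x≢z , xy , yz , xz) , uniq) one dx dy dz =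
  let (x' , X) = degree⇒link S dx
      (y' , Y) = degree⇒link (rot S) dy
      (z' , Z) = degree⇒link (rot (rot S)) dz
  in crystal-of-links S conn (one-component⇒linkReachable S Z one) X Y Z
  where
  in? : ∀ u → Dec (u ∈₃ (x , y , z))
  in? u = u ≟ x ⊎-dec u ≟ y ⊎-dec u ≟ z
  τ : Fin (n G) → Bool
  τ u = ⌊ in? u ⌋
  S : Setup G τ x y z
  S = record
    { xy = xy ; yz = yz ; xz = xz
    ; τx = fromWitness (inj₁ refl) ; τy = fromWitness (inj₂ (inj₁ refl)) ; τz = fromWitness (inj₂ (inj₂ refl))
    ; τ⁻ = toWitness
    ; only = λ a b c ab bc ac → fromWitness (proj₁ (uniq a b c
               (adj-irr G ab , adj-irr G bc , adj-irr G ac , ab , bc , ac)))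
    ; wed = wed }
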